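{- For every composition $\alpha$, \[ \mathcal{P}_\alpha = \sum_T (1-q)^{n(T)}\,M_{\mathrm{content}(T)}, \] the sum over all immaculate tableaux $T$ of shape $\alpha$ (whose content is a composition). Moreover, at $q=1$ one has $\mathcal{P}_\alpha=M_\alpha$ and at $q=0$ one has $\mathcal{P}_\alpha=\mathfrak{S}^*_\alpha$.
   Context: Work over $\mathbb{Q}(q)$. $\mathrm{NSym}$ is the free associative algebra on $H_1,H_2,\dots$ ($H_0=1$, $H_{ -r}=0$ for $r>0$), graded dual to $\mathrm{QSym}$ via $\langle H_{\alpha_1}\cdots H_{\alpha_k},M_\beta\rangle=\delta_{\alpha\beta}$ ($M_\beta$ monomial quasisymmetric functions), coproduct $\Delta(H_j)=\sum_iH_i\otimes H_{j-i}$. For $F\in\mathrm{QSym}$, $F^\perp$ satisfies $\langle F^\perp(H),G\rangle=\langle H,FG\rangle$. $F_i=\sum_{\gamma\models i}M_\gamma$ ($F_0=1$), $F_{1^i}=M_{1^i}$. Let $\mathbb{B}_m=\sum_{i\ge0}(-1)^iH_{m+i}F_{1^i}^\perp$, $\mathfrak{S}_\alpha=\mathbb{B}_{\alpha_1}\cdots\mathbb{B}_{\alpha_m}(1)$ with dual basis $\{\mathfrak{S}^*_\alpha\}$ in $\mathrm{QSym}$, $\widetilde{\mathbb{B}}_m(f)=\sum_{i\ge0}q^i\mathbb{B}_{m+i}(F_i^\perp(f))$, and $\mathcal{Q}'_\alpha=\widetilde{\mathbb{B}}_{\alpha_1}\cdots\widetilde{\mathbb{B}}_{\alpha_m}(1)$;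 the $\mathcal{Q}'_\alpha$ (over compositions) form a basis of $\mathbb{Q}(q)\otimes\mathrm{NSym}$ and $\{\mathcal{P}_\alpha\}$ is the dual basis of $\mathbb{Q}(q)\otimes\mathrm{QSym}$. An immaculate tableau of shape $\alpha$ and content $\beta$ (compositions) is a filling of the diagram of $\alpha$ (left-justified rows of lengths $\alpha_i$, row 1 on top) with positive integers, $\beta_i$ equal to $i$, rows weakly increasing, first column strictly increasing top to bottom. $n(T)=\sum_{j}(d_j(T)-1)$ over rows $j$, where $d_j(T)$ is the number of distinct entries in row $j$. -}

module Defs where

-- Formalisation conventions:
--  * coefficients live in Z[q] (polynomials, low degree first), a subring of Q(q);
--  * an element of NSym is a finite formal sum  sum c_w H_w  (list of (coefficient , word)),
--    an element of QSym a finite formal sum  sum c_w M_w  (same representation);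
--  * the pairing is  <H_u , M_v> = delta_{u v}  extended bilinearly.

open import Data.Bool using (Bool; true; false; _∧_; if_then_else_)
open import Data.Nat as ℕ using (ℕ; zero; suc; _∸_)
open import Data.Integer as ℤ using (ℤ; +_; -_)
open import Data.List using (List; []; _∷_; map; concatMap; concat; foldr; length;
  replicate; upTo; filterᵇ; deduplicate; take)
open import Data.List.Properties using (≡-dec)
open import Data.Nat.ListAction using (sum)
open import Data.Product using (_×_; _,_)
open import Relation.Binary.PropositionalEquality using (_≡_)
open import Relation.Nullary.Decidable using (does)

Poly : Set
Poly = List ℤ

infixl 6 _⊕_
infixl 7 _⊗_

_⊕_ : Poly → Poly → Poly
[] ⊕ r = r
(a ∷ p) ⊕ [] = a ∷ p
(a ∷ p) ⊕ (b ∷ r) = (a ℤ.+ b) ∷ (p ⊕ r)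

scalar : ℤ → Poly → Poly
scalar a = map (a ℤ.*_)

_⊗_ : Poly → Poly → Poly
[] ⊗ r = []
(a ∷ p) ⊗ r = scalar a r ⊕ ((+ 0) ∷ (p ⊗ r))

const : ℤ → Poly
const a = a ∷ []

0ₚ 1ₚ qₚ : Poly
0ₚ = []
1ₚ = const (+ 1)
qₚ = + 0 ∷ + 1 ∷ []

negₚ : Poly → Poly
negₚ = map -_

_^ₚ_ : Poly → ℕ → Poly
p ^ₚ zero = 1ₚ
p ^ₚ suc n = p ⊗ (p ^ₚ n)

coeff : Poly → ℕ → ℤ
coeff [] k = + 0
coeff (a ∷ p) zero = a
coeff (a ∷ p) (suc k) = coeff p k

_≈ₚ_ : Poly → Poly → Set
p ≈ₚ r = ∀ k → coeff p k ≡ coeff r k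

eval : ℤ → Poly → ℤ
eval x [] = + 0
eval x (a ∷ p) = a ℤ.+ x ℤ.* eval x p

Word : Set
Word = List ℕ

size : Word → ℕ
size = sum

_==_ : Word → Word → Bool
u == v = does (≡-dec ℕ._≟_ u v)

comps : ℕ → List Word
comps zero = [] ∷ []
comps (suc n) = concatMap step (comps n)
  where
  step : Word → List Word
  step [] = (1 ∷ []) ∷ []
  step (a ∷ c) = (1 ∷ a ∷ c) ∷ (suc a ∷ c) ∷ []

-- quasi-shuffle (stuffle):  M_u M_v = sum_{w in qsh u v} M_w
qsh : Word → Word → List Word
qsh [] v = v ∷ []
qsh (a ∷ u) [] = (a ∷ u) ∷ []
qsh (a ∷ u) (b ∷ v) =
  map (a ∷_) (qsh u (b ∷ v)) Data.List.++ map (b ∷_) (qsh (a ∷ u) v)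
  Data.List.++ map ((a ℕ.+ b) ∷_) (qsh u v)

countIn : Word → List Word → ℕ
countIn w [] = 0
countIn w (x ∷ xs) = if w == x then suc (countIn w xs) else countIn w xs

-- Linear combinations (NSym in the H-basis, QSym in the M-basis)

Lin : Set
Lin = List (Poly × Word)

δ : Word → Word → Poly
δ u v = if u == v then 1ₚ else 0ₚ

coeffOf : Lin → Word → Poly
coeffOf [] β = 0ₚ
coeffOf ((c , w) ∷ f) β = (if w == β then c else 0ₚ) ⊕ coeffOf f β

-- the pairing < f , g >  for f ∈ NSym (H-basis), g ∈ QSym (M-basis)
pair : Lin → Lin → Poly
pair [] g = 0ₚ
pair ((c , w) ∷ f) g = (c ⊗ coeffOf g w) ⊕ pair f g

scaleL : Poly → Lin → Lin
scaleL c = map (λ { (d , w) → (c ⊗ d , w) })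

one : Lin
one = (1ₚ , []) ∷ []

-- left multiplication by H_m  (H_0 = 1)
hL : ℕ → Lin → Lin
hL zero f = f
hL (suc k) f = map (λ { (d , w) → (d , suc k ∷ w) }) f

-- M_γ^⊥ : <M_γ^⊥(H_w), M_β> = <H_w, M_γ M_β> = multiplicity of w in qsh γ β
perpM : Word → Lin → Lin
perpM γ = concatMap (λ { (c , w) →
  map (λ β → (c ⊗ const (+ countIn w (qsh γ β)) , β)) (comps (size w ∸ size γ)) })

-- F_i^⊥ with F_i = sum_{γ ⊨ i} M_γ
perpF : ℕ → Lin → Lin
perpF i f = concatMap (λ γ → perpM γ f) (comps i)

-- F_{1^i}^⊥ = M_{1^i}^⊥
perpE : ℕ → Lin → Lin
perpE i = perpM (replicate i 1)

sign : ℕ → Poly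
sign zero = 1ₚ
sign (suc i) = negₚ (sign i)

-- B_m = sum_{i ≥ 0} (-1)^i H_{m+i} F_{1^i}^⊥   (terms i > |w| vanish on H_w)
B : ℕ → Lin → Lin
B m = concatMap (λ { (c , w) →
  concatMap (λ i → scaleL (sign i) (hL (m ℕ.+ i) (perpE i ((c , w) ∷ []))))
            (upTo (suc (size w))) })

-- B~_m (f) = sum_{i ≥ 0} q^i B_{m+i}(F_i^⊥ f)   (terms i > |w| vanish on H_w)
Bt : ℕ → Lin → Lin
Bt m = concatMap (λ { (c , w) →
  concatMap (λ i → scaleL (qₚ ^ₚ i) (B (m ℕ.+ i) (perpF i ((c , w) ∷ []))))
            (upTo (suc (size w))) })

S : Word → Lin
S α = foldr B one α

Q′ : Word → Lin
Q′ α = foldr Bt one α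

Tableau : Set
Tableau = List (List ℕ)

rowsIn : ℕ → ℕ → List (List ℕ)
rowsIn zero n = [] ∷ []
rowsIn (suc l) n = concatMap (λ x → map (x ∷_) (rowsIn l n)) (map suc (upTo n))

fillings : Word → ℕ → List Tableau
fillings [] n = [] ∷ []
fillings (a ∷ α) n = concatMap (λ r → map (r ∷_) (fillings α n)) (rowsIn a n)

weaklyIncr : List ℕ → Bool
weaklyIncr [] = true
weaklyIncr (x ∷ []) = true
weaklyIncr (x ∷ y ∷ xs) = (x ℕ.≤ᵇ y) ∧ weaklyIncr (y ∷ xs)

strictlyIncr : List ℕ → Bool
strictlyIncr [] = true
strictlyIncr (x ∷ []) = true
strictlyIncr (x ∷ y ∷ xs) = (x ℕ.<ᵇ y) ∧ strictlyIncr (y ∷ xs)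

firstColumn : Tableau → List ℕ
firstColumn = concatMap (take 1)

entries : Tableau → List ℕ
entries = concat

maxEntry : Tableau → ℕ
maxEntry T = foldr ℕ._⊔_ 0 (entries T)

countEntry : ℕ → Tableau → ℕ
countEntry i T = length (filterᵇ (λ x → x ℕ.≡ᵇ i) (entries T))

content : Tableau → Word
content T = map (λ i → countEntry (suc i) T) (upTo (maxEntry T))

allᵇ : {A : Set} → (A → Bool) → List A → Bool
allᵇ p [] = true
allᵇ p (x ∷ xs) = p x ∧ allᵇ p xs

isComposition : Word → Bool
isComposition = allᵇ (λ x → 0 ℕ.<ᵇ x)

isImmaculate : Tableau → Bool
isImmaculate T = allᵇ weaklyIncr T ∧ strictlyIncr (firstColumn T) ∧ isComposition (content T)

-- immaculate tableaux of shape α with composition content; such a content is a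
-- composition of |α|, so all entries lie in {1,…,|α|}
immTableaux : Word → List Tableau
immTableaux α = filterᵇ isImmaculate (fillings α (size α))

nStat : Tableau → ℕ
nStat T = sum (map (λ r → length (deduplicate ℕ._≟_ r) ∸ 1) T)

Rhs : Word → Lin
Rhs α = map (λ T → ((1ₚ ⊕ negₚ qₚ) ^ₚ nStat T , content T)) (immTableaux α)

spec : ℤ → Lin → Lin
spec x = map (λ { (c , w) → (const (eval x c) , w) })

IsComposition : Word → Set
IsComposition α = isComposition α ≡ true

{-# OPTIONS --safe #-}
-- Letting q be an integer x makes the coefficients integers, and this loses nothing. Dually to
-- B_m and B~_m there are operators B*_m and Bt*_m on QSym, expressed through the stuffle product
-- and the operator R_k : M_{k β} ↦ M_β. Removing the entries 1 from an immaculate tableau gives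
-- R_k P_{a α} = g_{a-k} P_α for k ≥ 1, where Σ g_n tⁿ = Π (1 - x z t) / (1 - z t) over the
-- variables z. Since B~_m multiplies by Σ (-t)^j e_j and Σ (x t)^i h_i, that is, by
-- Π (1 - z t) / (1 - x z t), everything cancels and Bt*_m P_{a α} is P_α for m = a and 0
-- otherwise; for B_m the same happens at x = 0.
-- Quasisymmetric functions are represented by their coefficients, extended to words with zero
-- letters by ignoring these; a product then becomes a sum over letterwise splittings.
module Submission where

-- Polynomials are unnormalised coefficient lists, equal only up to `≈ₚ`; evaluated at an integer,
-- each identity becomes an equation in ℤ. On compositions a product is awkward, because a letter
-- may go entirely to one factor and the positions then shift. With zero letters allowed, both
-- halves of a splitting keep the length of the word and each letter splits independently. An
-- identity between products over the variables z then reduces to one between power series in t: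
-- first (1 - t)(1 + (1 - x)(t + t² + ...)) = 1 - x t, and then (1 - x t) / (1 - x t) = 1. The same
-- alignment serves the tableaux: the position of a letter names a label, so the contents of rows
-- add letter by letter. The price is `flat`: the operators on NSym return compositions, so every
-- function involved must be shown insensitive to zero letters. `Rhs`, whose coefficients at words
-- with a zero letter vanish, is compared with `Z` on compositions only.

open import Defs
open import Data.Bool using (Bool; true; false; _∧_; T; if_then_else_)
open import Data.Bool.Properties using (∧-assoc; ∧-comm)
open import Data.Nat as ℕ using (ℕ; zero; suc; _∸_; z≤n; s≤s; _≤_; _<_)
import Data.Nat.Properties as ℕₚ
open import Data.Integer as ℤ using (ℤ; +_; -_; _+_; _*_; ∣_∣; 0ℤ; 1ℤ; -1ℤ)
import Data.Integer.Properties as ℤₚ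
open import Data.Integer.Tactic.RingSolver using (solve-∀)
open import Data.List using (List; []; _∷_; _++_; map; concatMap; foldr; length;
  replicate; upTo; applyUpTo; filterᵇ; deduplicate)
open import Data.List.Properties using (≡-dec; map-upTo; filter-idem; filter-all)
open import Data.List.Relation.Unary.All as All using (All; []; _∷_)
import Data.List.Relation.Unary.All.Properties as Allₚ
open import Data.Nat.ListAction using (sum)
open import Data.Product using (_×_; _,_; proj₁; proj₂)
open import Data.Sum using (_⊎_; inj₁; inj₂)
open import Data.Empty using (⊥-elim)
open import Data.Unit using (⊤; tt)
import Algebra.Properties.CommutativeSemigroup as CommutativeSemigroupₚ
open import Function using (_∘_; id)
open import Relation.Nullary using (¬_; yes; no; contradiction)
open import Relation.Binary.PropositionalEquality
open ≡-Reasoning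
open CommutativeSemigroupₚ ℤₚ.*-commutativeSemigroup using (x∙yz≈y∙xz; interchange)
open CommutativeSemigroupₚ ℤₚ.+-commutativeSemigroup using () renaming (interchange to +-interchange)
open CommutativeSemigroupₚ ℕₚ.+-commutativeSemigroup using () renaming (interchange to ℕ-interchange)

-- Finite sums

-- Sums over literal lists must not unfold, or unification could not recover the summands.
abstract
  ∑ : {A : Set} → List A → (A → ℤ) → ℤ
  ∑ []       f = 0ℤ
  ∑ (x ∷ xs) f = f x + ∑ xs f

  ∑-[] : {A : Set} (f : A → ℤ) → ∑ [] f ≡ 0ℤ
  ∑-[] f = refl

  ∑-∷ : {A : Set} (f : A → ℤ) (x : A) (xs : List A) → ∑ (x ∷ xs) f ≡ f x + ∑ xs f
  ∑-∷ f x xs = refl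

  ∑-cong-All : {A : Set} {P : A → Set} {f g : A → ℤ} {xs : List A} →
    All P xs → (∀ x → P x → f x ≡ g x) → ∑ xs f ≡ ∑ xs g
  ∑-cong-All []         eq = refl
  ∑-cong-All (px ∷ pxs) eq = cong₂ _+_ (eq _ px) (∑-cong-All pxs eq)

  ∑-++ : {A : Set} (f : A → ℤ) (xs ys : List A) → ∑ (xs ++ ys) f ≡ ∑ xs f + ∑ ys f
  ∑-++ f []       ys = sym (ℤₚ.+-identityˡ (∑ ys f))
  ∑-++ f (x ∷ xs) ys = trans (cong (_+_ (f x)) (∑-++ f xs ys)) (sym (ℤₚ.+-assoc (f x) (∑ xs f) (∑ ys f)))

  ∑-map : {A B : Set} (f : B → ℤ) (h : A → B) (xs : List A) → ∑ (map h xs) f ≡ ∑ xs (λ x → f (h x))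
  ∑-map f h []       = refl
  ∑-map f h (x ∷ xs) = cong (_+_ (f (h x))) (∑-map f h xs)

  ∑-+ : {A : Set} (f g : A → ℤ) (xs : List A) → ∑ xs (λ x → f x + g x) ≡ ∑ xs f + ∑ xs g
  ∑-+ f g []       = refl
  ∑-+ f g (x ∷ xs) =
    trans (cong (_+_ (f x + g x)) (∑-+ f g xs)) (+-interchange (f x) (g x) (∑ xs f) (∑ xs g))

  ∑-*ˡ : {A : Set} (c : ℤ) (f : A → ℤ) (xs : List A) → ∑ xs (λ x → c * f x) ≡ c * ∑ xs f
  ∑-*ˡ c f []       = sym (ℤₚ.*-zeroʳ c)
  ∑-*ˡ c f (x ∷ xs) =
    trans (cong (_+_ (c * f x)) (∑-*ˡ c f xs)) (sym (ℤₚ.*-distribˡ-+ c (f x) (∑ xs f)))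

∑-cong : {A : Set} {f g : A → ℤ} (xs : List A) → (∀ x → f x ≡ g x) → ∑ xs f ≡ ∑ xs g
∑-cong xs eq = ∑-cong-All (All.universal eq xs) (λ _ → id)

∑-zero : {A : Set} {f : A → ℤ} (xs : List A) → (∀ x → f x ≡ 0ℤ) → ∑ xs f ≡ 0ℤ
∑-zero {f = f} xs eq = trans (∑-cong xs eq) (∑-*ˡ 0ℤ (λ _ → 0ℤ) xs)

∑-[-] : {A : Set} (f : A → ℤ) (x : A) → ∑ (x ∷ []) f ≡ f x
∑-[-] f x = trans (∑-∷ f x []) (trans (cong (_+_ (f x)) (∑-[] f)) (ℤₚ.+-identityʳ (f x)))

∑-concatMap : {A B : Set} (f : B → ℤ) (h : A → List B) (xs : List A) →
  ∑ (concatMap h xs) f ≡ ∑ xs (λ x → ∑ (h x) f)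
∑-concatMap f h []       = trans (∑-[] f) (sym (∑-[] _))
∑-concatMap f h (x ∷ xs) = begin
  ∑ (h x ++ concatMap h xs) f       ≡⟨ ∑-++ f (h x) (concatMap h xs) ⟩
  ∑ (h x) f + ∑ (concatMap h xs) f  ≡⟨ cong (_+_ (∑ (h x) f)) (∑-concatMap f h xs) ⟩
  ∑ (h x) f + ∑ xs (λ x → ∑ (h x) f) ≡⟨ ∑-∷ _ x xs ⟨
  ∑ (x ∷ xs) (λ x → ∑ (h x) f)      ∎

∑-*ʳ : {A : Set} (c : ℤ) (f : A → ℤ) (xs : List A) → ∑ xs (λ x → f x * c) ≡ ∑ xs f * c
∑-*ʳ c f xs = trans (∑-cong xs (λ x → ℤₚ.*-comm (f x) c))
  (trans (∑-*ˡ c f xs) (ℤₚ.*-comm c (∑ xs f)))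

∑-swap : {A B : Set} (f : A → B → ℤ) (xs : List A) (ys : List B) →
  ∑ xs (λ x → ∑ ys (f x)) ≡ ∑ ys (λ y → ∑ xs (λ x → f x y))
∑-swap f []       ys = trans (∑-[] _) (sym (∑-zero ys (λ y → ∑-[] (λ x → f x y))))
∑-swap f (x ∷ xs) ys = begin
  ∑ (x ∷ xs) (λ x → ∑ ys (f x))                    ≡⟨ ∑-∷ _ x xs ⟩
  ∑ ys (f x) + ∑ xs (λ x → ∑ ys (f x))             ≡⟨ cong (_+_ (∑ ys (f x))) (∑-swap f xs ys) ⟩
  ∑ ys (f x) + ∑ ys (λ y → ∑ xs (λ x → f x y))     ≡⟨ ∑-+ (f x) _ ys ⟨
  ∑ ys (λ y → f x y + ∑ xs (λ x → f x y))          ≡⟨ ∑-cong ys (λ y → ∑-∷ (λ x → f x y) x xs) ⟨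
  ∑ ys (λ y → ∑ (x ∷ xs) (λ x → f x y))            ∎

⟦_⟧ : Bool → ℤ
⟦ true ⟧  = 1ℤ
⟦ false ⟧ = 0ℤ

⟦∧⟧ : ∀ b c → ⟦ b ∧ c ⟧ ≡ ⟦ b ⟧ * ⟦ c ⟧
⟦∧⟧ true  c = sym (ℤₚ.*-identityˡ ⟦ c ⟧)
⟦∧⟧ false c = refl

⟦⟧*-cong : ∀ b {s t : ℤ} → (b ≡ true → s ≡ t) → ⟦ b ⟧ * s ≡ ⟦ b ⟧ * t
⟦⟧*-cong true  eq = cong (1ℤ *_) (eq refl)
⟦⟧*-cong false eq = refl

⟦⟧-if : ∀ b (z : ℤ) → (if b then z else 0ℤ) ≡ ⟦ b ⟧ * z
⟦⟧-if true  z = sym (ℤₚ.*-identityˡ z)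
⟦⟧-if false z = refl

∑-filterᵇ : {A : Set} (f : A → ℤ) (p : A → Bool) (xs : List A) →
  ∑ (filterᵇ p xs) f ≡ ∑ xs (λ x → ⟦ p x ⟧ * f x)
∑-filterᵇ f p []       = trans (∑-[] f) (sym (∑-[] _))
∑-filterᵇ f p (x ∷ xs) = trans (step (p x) refl) (sym (∑-∷ _ x xs))
  where
  step : ∀ b → p x ≡ b →
    ∑ (filterᵇ p (x ∷ xs)) f ≡ ⟦ p x ⟧ * f x + ∑ xs (λ x → ⟦ p x ⟧ * f x)
  step true  eq rewrite eq = trans (∑-∷ f x _)
    (cong₂ _+_ (sym (ℤₚ.*-identityˡ (f x))) (∑-filterᵇ f p xs))
  step false eq rewrite eq = trans (∑-filterᵇ f p xs) (sym (ℤₚ.+-identityˡ _))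

∑-upTo-suc : (f : ℕ → ℤ) (n : ℕ) → ∑ (upTo (suc n)) f ≡ f 0 + ∑ (upTo n) (f ∘ suc)
∑-upTo-suc f n = trans (∑-∷ f 0 _) (cong (_+_ (f 0))
  (trans (cong (λ xs → ∑ xs f) (sym (map-upTo suc n))) (∑-map f suc (upTo n))))

∑-upTo-pick : (f : ℕ → ℤ) (n k : ℕ) → k < n → ∑ (upTo n) (λ i → ⟦ i ℕ.≡ᵇ k ⟧ * f i) ≡ f k
∑-upTo-pick f (suc n) zero    _         = begin
  ∑ (upTo (suc n)) (λ i → ⟦ i ℕ.≡ᵇ 0 ⟧ * f i)  ≡⟨ ∑-upTo-suc _ n ⟩
  1ℤ * f 0 + ∑ (upTo n) (λ i → 0ℤ * f (suc i)) ≡⟨ cong₂ _+_ (ℤₚ.*-identityˡ (f 0)) (∑-zero (upTo n) (λ _ → refl)) ⟩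
  f 0 + 0ℤ                                     ≡⟨ ℤₚ.+-identityʳ (f 0) ⟩
  f 0                                          ∎
∑-upTo-pick f (suc n) (suc k) (s≤s k<n) = begin
  ∑ (upTo (suc n)) (λ i → ⟦ i ℕ.≡ᵇ suc k ⟧ * f i)      ≡⟨ ∑-upTo-suc _ n ⟩
  0ℤ + ∑ (upTo n) (λ i → ⟦ i ℕ.≡ᵇ k ⟧ * f (suc i))     ≡⟨ ℤₚ.+-identityˡ _ ⟩
  ∑ (upTo n) (λ i → ⟦ i ℕ.≡ᵇ k ⟧ * f (suc i))          ≡⟨ ∑-upTo-pick (f ∘ suc) n k k<n ⟩
  f (suc k)                                            ∎

-- Splittings of numbers and of words, letter by letter

halves : ℕ → List (ℕ × ℕ)
halves zero    = (0 , 0) ∷ []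
halves (suc n) = (0 , suc n) ∷ map (λ (i , j) → (suc i , j)) (halves n)

∑-halves-suc : (f : ℕ × ℕ → ℤ) (n : ℕ) →
  ∑ (halves (suc n)) f ≡ f (0 , suc n) + ∑ (halves n) (λ (i , j) → f (suc i , j))
∑-halves-suc f n = trans (∑-∷ f (0 , suc n) _) (cong (_+_ (f (0 , suc n))) (∑-map f _ (halves n)))

∑-halves-0 : (f : ℕ × ℕ → ℤ) → ∑ (halves 0) f ≡ f (0 , 0)
∑-halves-0 f = ∑-[-] f (0 , 0)

halves-sum : ∀ n → All (λ (i , j) → i ℕ.+ j ≡ n) (halves n)
halves-sum zero    = refl ∷ []
halves-sum (suc n) = refl ∷ Allₚ.map⁺ (All.map (cong suc) (halves-sum n))

-- Both sides run over all i + k + l = n. The terms with i = 0 are taken out on both sides, and what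
-- remains is the statement for `φ ∘ suc`.
∑-halves-assoc : (φ : ℕ → ℕ → ℕ → ℤ) (n : ℕ) →
  ∑ (halves n) (λ (i , j) → ∑ (halves j) (λ (k , l) → φ i k l)) ≡
  ∑ (halves n) (λ (m , l) → ∑ (halves m) (λ (i , k) → φ i k l))
∑-halves-assoc φ zero    = trans (∑-halves-0 _)
  (trans (∑-halves-0 _) (sym (trans (∑-halves-0 _) (∑-halves-0 _))))
∑-halves-assoc φ (suc n) = begin
  ∑ (halves (suc n)) (λ (i , j) → ∑ (halves j) (λ (k , l) → φ i k l))
    ≡⟨ ∑-halves-suc _ n ⟩
  ∑ (halves (suc n)) (λ (k , l) → φ 0 k l)
    + ∑ (halves n) (λ (i , j) → ∑ (halves j) (λ (k , l) → φ (suc i) k l))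
    ≡⟨ cong₂ _+_ (∑-halves-suc _ n) (∑-halves-assoc (φ ∘ suc) n) ⟩
  (φ 0 0 (suc n) + ∑ (halves n) (λ (k , l) → φ 0 (suc k) l))
    + ∑ (halves n) (λ (m , l) → ∑ (halves m) (λ (i , k) → φ (suc i) k l))
    ≡⟨ ℤₚ.+-assoc (φ 0 0 (suc n)) _ _ ⟩
  φ 0 0 (suc n) + (∑ (halves n) (λ (k , l) → φ 0 (suc k) l)
    + ∑ (halves n) (λ (m , l) → ∑ (halves m) (λ (i , k) → φ (suc i) k l)))
    ≡⟨ cong (_+_ (φ 0 0 (suc n))) (∑-+ _ _ (halves n)) ⟨
  φ 0 0 (suc n) + ∑ (halves n) (λ (m , l) → φ 0 (suc m) l + ∑ (halves m) (λ (i , k) → φ (suc i) k l))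
    ≡⟨ cong₂ _+_ (∑-halves-0 (λ (i , k) → φ i k (suc n)))
         (∑-cong (halves n) (λ (m , l) → ∑-halves-suc (λ (i , k) → φ i k l) m)) ⟨
  ∑ (halves 0) (λ (i , k) → φ i k (suc n))
    + ∑ (halves n) (λ (m , l) → ∑ (halves (suc m)) (λ (i , k) → φ i k l))
    ≡⟨ ∑-halves-suc _ n ⟨
  ∑ (halves (suc n)) (λ (m , l) → ∑ (halves m) (λ (i , k) → φ i k l)) ∎

splits : Word → List (Word × Word)
splits []      = ([] , []) ∷ []
splits (b ∷ u) = concatMap (λ (i , j) → map (λ (v , w) → (i ∷ v , j ∷ w)) (splits u)) (halves b)

∑-splits-∷ : (f : Word × Word → ℤ) (b : ℕ) (u : Word) →
  ∑ (splits (b ∷ u)) f ≡ ∑ (halves b) (λ (i , j) → ∑ (splits u) (λ (v , w) → f (i ∷ v , j ∷ w)))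
∑-splits-∷ f b u = trans (∑-concatMap f _ (halves b)) (∑-cong (halves b) (λ _ → ∑-map f _ (splits u)))

∑-splits-[] : (f : Word × Word → ℤ) → ∑ (splits []) f ≡ f ([] , [])
∑-splits-[] f = ∑-[-] f ([] , [])

splits-sum : ∀ u → All (λ (v , w) → sum v ℕ.+ sum w ≡ sum u) (splits u)
splits-sum []      = refl ∷ []
splits-sum (b ∷ u) = Allₚ.concat⁺ (Allₚ.map⁺ (All.map go (halves-sum b)))
  where
  go : {ij : ℕ × ℕ} → proj₁ ij ℕ.+ proj₂ ij ≡ b →
    All (λ (v , w) → sum v ℕ.+ sum w ≡ b ℕ.+ sum u)
        (map (λ (v , w) → (proj₁ ij ∷ v , proj₂ ij ∷ w)) (splits u))
  go {i , j} eq = Allₚ.map⁺ (All.map (λ {(v , w)} eq′ →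
    trans (ℕ-interchange i (sum v) j (sum w)) (cong₂ ℕ._+_ eq eq′)) (splits-sum u))

splits-length : ∀ u → All (λ (v , w) → length v ≡ length u × length w ≡ length u) (splits u)
splits-length []      = (refl , refl) ∷ []
splits-length (b ∷ u) = Allₚ.concat⁺ (Allₚ.map⁺ (All.universal (λ _ →
  Allₚ.map⁺ (All.map (λ (p , r) → cong suc p , cong suc r) (splits-length u))) (halves b)))

-- This is associativity of the product, read on coefficients. Exchanging sums brings the two
-- splittings of the head letter together, where `∑-halves-assoc` applies.
∑-splits-assoc : (φ : Word → Word → Word → ℤ) (u : Word) →
  ∑ (splits u) (λ (r , w) → ∑ (splits w) (λ (s , t) → φ r s t)) ≡
  ∑ (splits u) (λ (v , t) → ∑ (splits v) (λ (r , s) → φ r s t))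
∑-splits-assoc φ []      = trans (∑-splits-[] _)
  (trans (∑-splits-[] _) (sym (trans (∑-splits-[] _) (∑-splits-[] _))))
∑-splits-assoc φ (b ∷ u) = begin
  ∑ (splits (b ∷ u)) (λ (r , w) → ∑ (splits w) (λ (s , t) → φ r s t))
    ≡⟨ ∑-splits-∷ _ b u ⟩
  ∑ (halves b) (λ (i , j) → ∑ (splits u) (λ (r , w) → ∑ (splits (j ∷ w)) (λ (s , t) → φ (i ∷ r) s t)))
    ≡⟨ ∑-cong (halves b) (λ (i , j) → ∑-cong (splits u) (λ (r , w) → ∑-splits-∷ _ j w)) ⟩
  ∑ (halves b) (λ (i , j) → ∑ (splits u) (λ (r , w) → ∑ (halves j) (λ (k , l) → ∑ (splits w) (λ (s , t) → φ (i ∷ r) (k ∷ s) (l ∷ t)))))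
    ≡⟨ ∑-cong (halves b) (λ (i , j) → ∑-swap _ (splits u) (halves j)) ⟩
  ∑ (halves b) (λ (i , j) → ∑ (halves j) (λ (k , l) → ∑ (splits u) (λ (r , w) → ∑ (splits w) (λ (s , t) → φ (i ∷ r) (k ∷ s) (l ∷ t)))))
    ≡⟨ ∑-cong (halves b) (λ (i , j) → ∑-cong (halves j) (λ (k , l) →
         ∑-splits-assoc (λ r s t → φ (i ∷ r) (k ∷ s) (l ∷ t)) u)) ⟩
  ∑ (halves b) (λ (i , j) → ∑ (halves j) (λ (k , l) → ∑ (splits u) (λ (v , t) → ∑ (splits v) (λ (r , s) → φ (i ∷ r) (k ∷ s) (l ∷ t)))))
    ≡⟨ ∑-halves-assoc (λ i k l → ∑ (splits u) (λ (v , t) → ∑ (splits v) (λ (r , s) → φ (i ∷ r) (k ∷ s) (l ∷ t)))) b ⟩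
  ∑ (halves b) (λ (m , l) → ∑ (halves m) (λ (i , k) → ∑ (splits u) (λ (v , t) → ∑ (splits v) (λ (r , s) → φ (i ∷ r) (k ∷ s) (l ∷ t)))))
    ≡⟨ ∑-cong (halves b) (λ (m , l) → ∑-swap _ (halves m) (splits u)) ⟩
  ∑ (halves b) (λ (m , l) → ∑ (splits u) (λ (v , t) → ∑ (halves m) (λ (i , k) → ∑ (splits v) (λ (r , s) → φ (i ∷ r) (k ∷ s) (l ∷ t)))))
    ≡⟨ ∑-cong (halves b) (λ (m , l) → ∑-cong (splits u) (λ (v , t) → ∑-splits-∷ _ m v)) ⟨
  ∑ (halves b) (λ (m , l) → ∑ (splits u) (λ (v , t) → ∑ (splits (m ∷ v)) (λ (r , s) → φ r s (l ∷ t))))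
    ≡⟨ ∑-splits-∷ _ b u ⟨
  ∑ (splits (b ∷ u)) (λ (v , t) → ∑ (splits v) (λ (r , s) → φ r s t)) ∎

-- Multiplicative functions on words

-- For `f 0 ≡ 1ℤ` this is the coefficient at `u` of the product over all variables z of the power
-- series Σ f(b) z^b.
mult : (ℕ → ℤ) → Word → ℤ
mult f []      = 1ℤ
mult f (b ∷ u) = f b * mult f u

_⊛_ : (ℕ → ℤ) → (ℕ → ℤ) → ℕ → ℤ
(f ⊛ g) b = ∑ (halves b) (λ (i , j) → f i * g j)

mult-cong : {f g : ℕ → ℤ} → (∀ b → f b ≡ g b) → ∀ u → mult f u ≡ mult g u
mult-cong eq []      = refl
mult-cong eq (b ∷ u) = cong₂ _*_ (eq b) (mult-cong eq u)

-- Products over the variables multiply variable by variable, so the series in one variable multiply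
-- by the Cauchy product `⊛`. This reduces identities in QSym to identities in one variable.
mult-⊛ : ∀ f g u → ∑ (splits u) (λ (v , w) → mult f v * mult g w) ≡ mult (f ⊛ g) u
mult-⊛ f g []      = ∑-splits-[] _
mult-⊛ f g (b ∷ u) = begin
  ∑ (splits (b ∷ u)) (λ (v , w) → mult f v * mult g w)
    ≡⟨ ∑-splits-∷ _ b u ⟩
  ∑ (halves b) (λ (i , j) → ∑ (splits u) (λ (v , w) → f i * mult f v * (g j * mult g w)))
    ≡⟨ ∑-cong (halves b) (λ (i , j) → ∑-cong (splits u) (λ (v , w) →
         interchange (f i) (mult f v) (g j) (mult g w))) ⟩
  ∑ (halves b) (λ (i , j) → ∑ (splits u) (λ (v , w) → f i * g j * (mult f v * mult g w)))
    ≡⟨ ∑-cong (halves b) (λ (i , j) → ∑-*ˡ (f i * g j) _ (splits u)) ⟩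
  ∑ (halves b) (λ (i , j) → f i * g j * ∑ (splits u) (λ (v , w) → mult f v * mult g w))
    ≡⟨ ∑-*ʳ _ (λ (i , j) → f i * g j) (halves b) ⟩
  (f ⊛ g) b * ∑ (splits u) (λ (v , w) → mult f v * mult g w)
    ≡⟨ cong ((f ⊛ g) b *_) (mult-⊛ f g u) ⟩
  (f ⊛ g) b * mult (f ⊛ g) u ∎

-- mult at the generating functions 1 + c t, 1 + y (t + t² + …) and 1 / (1 - x t).

linear : ℤ → ℕ → ℤ
linear c zero          = 1ℤ
linear c (suc zero)    = c
linear c (suc (suc b)) = 0ℤ

constant⁺ : ℤ → ℕ → ℤ
constant⁺ y zero    = 1ℤ
constant⁺ y (suc b) = y

-- 1 + (1 - x)(t + t² + ...) equals (1 - x t) / (1 - t), and the factor 1 - t cancels the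
-- denominator.
linear-⊛-constant⁺ : ∀ x b → (linear -1ℤ ⊛ constant⁺ (1ℤ + - x)) b ≡ linear (- x) b
linear-⊛-constant⁺ x zero          = ∑-halves-0 _
linear-⊛-constant⁺ x (suc zero)    = trans (trans (∑-halves-suc _ 0) (cong (_+_ (1ℤ * (1ℤ + - x))) (∑-halves-0 _))) (lemma x)
  where
  lemma : ∀ x → 1ℤ * (1ℤ + - x) + -1ℤ * 1ℤ ≡ - x
  lemma = solve-∀
linear-⊛-constant⁺ x (suc (suc b)) = begin
  ∑ (halves (2 ℕ.+ b)) f                                 ≡⟨ ∑-halves-suc f (suc b) ⟩
  1ℤ * y + ∑ (halves (suc b)) (λ (i , j) → f (suc i , j)) ≡⟨ cong (_+_ (1ℤ * y)) (∑-halves-suc _ b) ⟩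
  1ℤ * y + (-1ℤ * y + ∑ (halves b) (λ _ → 0ℤ))           ≡⟨ cong (λ e → 1ℤ * y + (-1ℤ * y + e)) (∑-zero (halves b) (λ _ → refl)) ⟩
  1ℤ * y + (-1ℤ * y + 0ℤ)                                ≡⟨ lemma y ⟩
  0ℤ                                                     ∎
  where
  y : ℤ
  y = 1ℤ + - x
  f : ℕ × ℕ → ℤ
  f (i , j) = linear -1ℤ i * constant⁺ y j
  lemma : ∀ y → 1ℤ * y + (-1ℤ * y + 0ℤ) ≡ 0ℤ
  lemma = solve-∀

-- Separating i = 0 gives a recursion: the coefficient at b + 1 is that of 1 - x t plus x times the
-- coefficient at b.
geometric-⊛-linear : ∀ x b → ((x ℤ.^_) ⊛ linear (- x)) b ≡ linear 0ℤ b
geometric-⊛-linear x zero    = ∑-halves-0 _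
geometric-⊛-linear x (suc b) = begin
  ((x ℤ.^_) ⊛ linear (- x)) (suc b)
    ≡⟨ ∑-halves-suc _ b ⟩
  1ℤ * linear (- x) (suc b) + ∑ (halves b) (λ (i , j) → x * x ℤ.^ i * linear (- x) j)
    ≡⟨ cong (_+_ (1ℤ * linear (- x) (suc b))) (trans
         (∑-cong (halves b) (λ (i , j) → ℤₚ.*-assoc x (x ℤ.^ i) (linear (- x) j)))
         (∑-*ˡ x _ (halves b))) ⟩
  1ℤ * linear (- x) (suc b) + x * ((x ℤ.^_) ⊛ linear (- x)) b
    ≡⟨ cong (λ e → 1ℤ * linear (- x) (suc b) + x * e) (geometric-⊛-linear x b) ⟩
  1ℤ * linear (- x) (suc b) + x * linear 0ℤ b
    ≡⟨ cancel b ⟩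
  linear 0ℤ (suc b) ∎
  where
  cancel₀ : ∀ x → 1ℤ * - x + x * 1ℤ ≡ 0ℤ
  cancel₀ = solve-∀
  cancel₁ : ∀ x → 1ℤ * 0ℤ + x * 0ℤ ≡ 0ℤ
  cancel₁ = solve-∀
  cancel : ∀ b → 1ℤ * linear (- x) (suc b) + x * linear 0ℤ b ≡ linear 0ℤ (suc b)
  cancel zero          = cancel₀ x
  cancel (suc zero)    = cancel₁ x
  cancel (suc (suc b)) = cancel₁ x

mult-geometric : ∀ x u → mult (x ℤ.^_) u ≡ x ℤ.^ sum u
mult-geometric x []      = refl
mult-geometric x (b ∷ u) = trans (cong (x ℤ.^ b *_) (mult-geometric x u))
  (sym (ℤₚ.^-distribˡ-+-* x b (sum u)))

-- `mult (linear 0ℤ)` is the unit 1, supported on words of zeros, so only the splitting with `w`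
-- equal to `u` survives. `Ψ` takes `sum v` as a separate argument so that the induction can shift
-- it by the head letter.
∑-splits-linear-0 : (Ψ : ℕ → Word → ℤ) (u : Word) →
  ∑ (splits u) (λ (v , w) → mult (linear 0ℤ) v * Ψ (sum v) w) ≡ Ψ 0 u
∑-splits-linear-0 Ψ []      = trans (∑-splits-[] _) (ℤₚ.*-identityˡ _)
∑-splits-linear-0 Ψ (b ∷ u) = begin
  ∑ (splits (b ∷ u)) (λ (v , w) → mult (linear 0ℤ) v * Ψ (sum v) w)
    ≡⟨ ∑-splits-∷ _ b u ⟩
  ∑ (halves b) (λ (i , j) → ∑ (splits u) (λ (v , w) →
    linear 0ℤ i * mult (linear 0ℤ) v * Ψ (i ℕ.+ sum v) (j ∷ w)))
    ≡⟨ ∑-cong (halves b) (λ (i , j) → trans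
         (∑-cong (splits u) (λ (v , w) → ℤₚ.*-assoc (linear 0ℤ i) _ _))
         (∑-*ˡ (linear 0ℤ i) _ (splits u))) ⟩
  ∑ (halves b) (λ (i , j) → linear 0ℤ i * ∑ (splits u) (λ (v , w) →
    mult (linear 0ℤ) v * Ψ (i ℕ.+ sum v) (j ∷ w)))
    ≡⟨ ∑-cong (halves b) (λ (i , j) → cong (linear 0ℤ i *_)
         (∑-splits-linear-0 (λ n w → Ψ (i ℕ.+ n) (j ∷ w)) u)) ⟩
  ∑ (halves b) (λ (i , j) → linear 0ℤ i * Ψ (i ℕ.+ 0) (j ∷ u))
    ≡⟨ head b ⟩
  Ψ 0 (b ∷ u) ∎
  where
  linear-0-suc : ∀ i → linear 0ℤ (suc i) ≡ 0ℤ
  linear-0-suc zero    = refl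
  linear-0-suc (suc i) = refl
  head : ∀ b → ∑ (halves b) (λ (i , j) → linear 0ℤ i * Ψ (i ℕ.+ 0) (j ∷ u)) ≡ Ψ 0 (b ∷ u)
  head zero    = trans (∑-halves-0 _) (ℤₚ.*-identityˡ _)
  head (suc b) = begin
    _ ≡⟨ ∑-halves-suc _ b ⟩
    1ℤ * Ψ 0 (suc b ∷ u) + ∑ (halves b) (λ (i , j) → linear 0ℤ (suc i) * Ψ (suc i ℕ.+ 0) (j ∷ u))
      ≡⟨ cong₂ _+_ (ℤₚ.*-identityˡ (Ψ 0 (suc b ∷ u))) (∑-zero (halves b) (λ (i , j) →
           cong (_* Ψ (suc i ℕ.+ 0) (j ∷ u)) (linear-0-suc i))) ⟩
    Ψ 0 (suc b ∷ u) + 0ℤ ≡⟨ ℤₚ.+-identityʳ _ ⟩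
    Ψ 0 (suc b ∷ u) ∎

-- The coefficients of P_α by recursion on words

-- The coefficient at `u` of the product of `Ψ` with the part of degree a - k of Π f(z). The degree
-- condition is additive because truncated subtraction would confuse k > a with k = a.
weighted : (ℕ → ℤ) → ℕ → ℕ → (Word → ℤ) → Word → ℤ
weighted f k a Ψ u = ∑ (splits u) (λ (v , w) → ⟦ k ℕ.+ sum v ℕ.≡ᵇ a ⟧ * (mult f v * Ψ w))

-- Z (1 - x) α u is the coefficient of P_α at u for q = x. The words (v , w) split u into what is
-- left of the first row after removing its smallest entries, and the other rows.
Z : ℤ → Word → Word → ℤ
Z y []      u           = mult (linear 0ℤ) u
Z y (a ∷ α) []          = 0ℤ
Z y (a ∷ α) (zero ∷ u)  = Z y (a ∷ α) u
Z y (a ∷ α) (suc k ∷ u) = weighted (constant⁺ y) (suc k) a (Z y α) u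

weighted-cong : ∀ {f g} k a Ψ u → (∀ b → f b ≡ g b) → weighted f k a Ψ u ≡ weighted g k a Ψ u
weighted-cong k a Ψ u eq = ∑-cong (splits u) (λ (v , w) →
  cong (λ e → ⟦ k ℕ.+ sum v ℕ.≡ᵇ a ⟧ * (e * Ψ w)) (mult-cong eq v))

-- After reassociation the degree condition depends on `r` and `s` only through the word `v` that
-- they split, so it leaves the inner sum and `mult-⊛` applies.
weighted-⊛ : ∀ f g k a Ψ u →
  ∑ (splits u) (λ (v , w) → mult f v * weighted g (k ℕ.+ sum v) a Ψ w) ≡ weighted (f ⊛ g) k a Ψ u
weighted-⊛ f g k a Ψ u = begin
  ∑ (splits u) (λ (r , w) → mult f r * weighted g (k ℕ.+ sum r) a Ψ w)
    ≡⟨ ∑-cong (splits u) (λ (r , w) → ∑-*ˡ (mult f r) _ (splits w)) ⟨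
  ∑ (splits u) (λ (r , w) → ∑ (splits w) (λ (s , t) →
    mult f r * (⟦ k ℕ.+ sum r ℕ.+ sum s ℕ.≡ᵇ a ⟧ * (mult g s * Ψ t))))
    ≡⟨ ∑-splits-assoc (λ r s t →
         mult f r * (⟦ k ℕ.+ sum r ℕ.+ sum s ℕ.≡ᵇ a ⟧ * (mult g s * Ψ t))) u ⟩
  ∑ (splits u) (λ (v , t) → ∑ (splits v) (λ (r , s) →
    mult f r * (⟦ k ℕ.+ sum r ℕ.+ sum s ℕ.≡ᵇ a ⟧ * (mult g s * Ψ t))))
    ≡⟨ ∑-cong (splits u) (λ (v , t) → inner v t) ⟩
  weighted (f ⊛ g) k a Ψ u ∎
  where
  rearrange : ∀ p q r s → p * (q * (r * s)) ≡ p * r * (q * s)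
  rearrange = solve-∀
  inner : ∀ v t → ∑ (splits v) (λ (r , s) →
    mult f r * (⟦ k ℕ.+ sum r ℕ.+ sum s ℕ.≡ᵇ a ⟧ * (mult g s * Ψ t)))
    ≡ ⟦ k ℕ.+ sum v ℕ.≡ᵇ a ⟧ * (mult (f ⊛ g) v * Ψ t)
  inner v t = begin
    ∑ (splits v) (λ (r , s) →
      mult f r * (⟦ k ℕ.+ sum r ℕ.+ sum s ℕ.≡ᵇ a ⟧ * (mult g s * Ψ t)))
      ≡⟨ ∑-cong-All (splits-sum v) (λ (r , s) eq → trans
           (cong (λ e → mult f r * (⟦ e ℕ.≡ᵇ a ⟧ * (mult g s * Ψ t)))
             (trans (ℕₚ.+-assoc k (sum r) (sum s)) (cong (k ℕ.+_) eq)))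
           (rearrange (mult f r) ⟦ k ℕ.+ sum v ℕ.≡ᵇ a ⟧ (mult g s) (Ψ t))) ⟩
    ∑ (splits v) (λ (r , s) → mult f r * mult g s * (⟦ k ℕ.+ sum v ℕ.≡ᵇ a ⟧ * Ψ t))
      ≡⟨ ∑-*ʳ _ (λ (r , s) → mult f r * mult g s) (splits v) ⟩
    ∑ (splits v) (λ (r , s) → mult f r * mult g s) * (⟦ k ℕ.+ sum v ℕ.≡ᵇ a ⟧ * Ψ t)
      ≡⟨ cong (_* (⟦ k ℕ.+ sum v ℕ.≡ᵇ a ⟧ * Ψ t)) (mult-⊛ f g v) ⟩
    mult (f ⊛ g) v * (⟦ k ℕ.+ sum v ℕ.≡ᵇ a ⟧ * Ψ t)
      ≡⟨ x∙yz≈y∙xz (mult (f ⊛ g) v) ⟦ k ℕ.+ sum v ℕ.≡ᵇ a ⟧ (Ψ t) ⟩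
    ⟦ k ℕ.+ sum v ℕ.≡ᵇ a ⟧ * (mult (f ⊛ g) v * Ψ t) ∎

weighted-linear-0 : ∀ k a Ψ u → weighted (linear 0ℤ) k a Ψ u ≡ ⟦ k ℕ.≡ᵇ a ⟧ * Ψ u
weighted-linear-0 k a Ψ u = begin
  weighted (linear 0ℤ) k a Ψ u
    ≡⟨ ∑-cong (splits u) (λ (v , w) → x∙yz≈y∙xz ⟦ k ℕ.+ sum v ℕ.≡ᵇ a ⟧ (mult (linear 0ℤ) v) (Ψ w)) ⟩
  ∑ (splits u) (λ (v , w) → mult (linear 0ℤ) v * (⟦ k ℕ.+ sum v ℕ.≡ᵇ a ⟧ * Ψ w))
    ≡⟨ ∑-splits-linear-0 (λ n w → ⟦ k ℕ.+ n ℕ.≡ᵇ a ⟧ * Ψ w) u ⟩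
  ⟦ k ℕ.+ 0 ℕ.≡ᵇ a ⟧ * Ψ u
    ≡⟨ cong (λ e → ⟦ e ℕ.≡ᵇ a ⟧ * Ψ u) (ℕₚ.+-identityʳ k) ⟩
  ⟦ k ℕ.≡ᵇ a ⟧ * Ψ u ∎

-- The head letter is positive, so `Z` unfolds to `weighted` with shift `suc m ℕ.+ sum v`, which is
-- the shape that `weighted-⊛` multiplies out.
Z-B : ∀ x a α m u →
  ∑ (splits u) (λ (v , w) → mult (linear -1ℤ) v * Z (1ℤ + - x) (a ∷ α) (suc m ℕ.+ sum v ∷ w))
  ≡ weighted (linear (- x)) (suc m) a (Z (1ℤ + - x) α) u
Z-B x a α m u = trans
  (weighted-⊛ (linear -1ℤ) (constant⁺ (1ℤ + - x)) (suc m) a (Z (1ℤ + - x) α) u)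
  (weighted-cong (suc m) a (Z (1ℤ + - x) α) u (linear-⊛-constant⁺ x))

-- The powers of x are the coefficients of Π 1 / (1 - x z), which cancels the factor left by `Z-B`.
-- Only the unit remains, and its single degree 0 forces the row length to be `suc m`.
Z-Bt : ∀ x a α m u →
  ∑ (splits u) (λ (v , w) → x ℤ.^ sum v
    * weighted (linear (- x)) (suc m ℕ.+ sum v) a (Z (1ℤ + - x) α) w)
  ≡ ⟦ suc m ℕ.≡ᵇ a ⟧ * Z (1ℤ + - x) α u
Z-Bt x a α m u = begin
  ∑ (splits u) (λ (v , w) → x ℤ.^ sum v
    * weighted (linear (- x)) (suc m ℕ.+ sum v) a (Z (1ℤ + - x) α) w)
    ≡⟨ ∑-cong (splits u) (λ (v , w) → cong
         (_* weighted (linear (- x)) (suc m ℕ.+ sum v) a (Z (1ℤ + - x) α) w) (mult-geometric x v)) ⟨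
  ∑ (splits u) (λ (v , w) → mult (x ℤ.^_) v
    * weighted (linear (- x)) (suc m ℕ.+ sum v) a (Z (1ℤ + - x) α) w)
    ≡⟨ weighted-⊛ (x ℤ.^_) (linear (- x)) (suc m) a (Z (1ℤ + - x) α) u ⟩
  weighted ((x ℤ.^_) ⊛ linear (- x)) (suc m) a (Z (1ℤ + - x) α) u
    ≡⟨ weighted-cong (suc m) a (Z (1ℤ + - x) α) u (geometric-⊛-linear x) ⟩
  weighted (linear 0ℤ) (suc m) a (Z (1ℤ + - x) α) u
    ≡⟨ weighted-linear-0 (suc m) a (Z (1ℤ + - x) α) u ⟩
  ⟦ suc m ℕ.≡ᵇ a ⟧ * Z (1ℤ + - x) α u ∎

-- Deleting zero letters

flat : Word → Word
flat []          = []
flat (zero ∷ u)  = flat u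
flat (suc k ∷ u) = suc k ∷ flat u

flat-sum : ∀ u → sum (flat u) ≡ sum u
flat-sum []          = refl
flat-sum (zero ∷ u)  = flat-sum u
flat-sum (suc k ∷ u) = cong (suc k ℕ.+_) (flat-sum u)

flat-composition : ∀ u → IsComposition (flat u)
flat-composition []          = refl
flat-composition (zero ∷ u)  = flat-composition u
flat-composition (suc k ∷ u) = flat-composition u

flat-idem : ∀ u → flat (flat u) ≡ flat u
flat-idem []          = refl
flat-idem (zero ∷ u)  = flat-idem u
flat-idem (suc k ∷ u) = cong (suc k ∷_) (flat-idem u)

flat-∷-flat : ∀ i u → flat (i ∷ flat u) ≡ flat (i ∷ u)
flat-∷-flat zero    u = flat-idem u
flat-∷-flat (suc i) u = cong (suc i ∷_) (flat-idem u)

-- A zero letter splits only as 0 + 0, and an invariant `φ` does not see the two zeros.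
∑-splits-flat : (φ : Word → Word → ℤ) →
  (∀ v w → φ (flat v) (flat w) ≡ φ v w) → ∀ u →
  ∑ (splits (flat u)) (λ (v , w) → φ v w) ≡ ∑ (splits u) (λ (v , w) → φ v w)
∑-splits-flat φ inv []          = refl
∑-splits-flat φ inv (zero ∷ u)  = begin
  ∑ (splits (flat u)) (λ (v , w) → φ v w)          ≡⟨ ∑-splits-flat φ inv u ⟩
  ∑ (splits u) (λ (v , w) → φ v w)                 ≡⟨ ∑-cong (splits u) (λ (v , w) → trans (sym (inv v w)) (inv (0 ∷ v) (0 ∷ w))) ⟩
  ∑ (splits u) (λ (v , w) → φ (0 ∷ v) (0 ∷ w))     ≡⟨ ∑-halves-0 _ ⟨
  ∑ (halves 0) (λ (i , j) → ∑ (splits u) (λ (v , w) → φ (i ∷ v) (j ∷ w)))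
                                                   ≡⟨ ∑-splits-∷ _ 0 u ⟨
  ∑ (splits (0 ∷ u)) (λ (v , w) → φ v w)           ∎
∑-splits-flat φ inv (suc k ∷ u) = begin
  ∑ (splits (suc k ∷ flat u)) (λ (v , w) → φ v w)
    ≡⟨ ∑-splits-∷ _ (suc k) (flat u) ⟩
  ∑ (halves (suc k)) (λ (i , j) → ∑ (splits (flat u)) (λ (v , w) → φ (i ∷ v) (j ∷ w)))
    ≡⟨ ∑-cong (halves (suc k)) (λ (i , j) → ∑-splits-flat (λ v w → φ (i ∷ v) (j ∷ w))
         -- Invariance survives prefixing letters: `i ∷ flat v` and `i ∷ v` flatten to the same
         -- word, whether or not `i` is zero.
         (λ v w → trans (sym (inv (i ∷ flat v) (j ∷ flat w)))
           (trans (cong₂ φ (flat-∷-flat i v) (flat-∷-flat j w)) (inv (i ∷ v) (j ∷ w)))) u) ⟩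
  ∑ (halves (suc k)) (λ (i , j) → ∑ (splits u) (λ (v , w) → φ (i ∷ v) (j ∷ w)))
    ≡⟨ ∑-splits-∷ _ (suc k) u ⟨
  ∑ (splits (suc k ∷ u)) (λ (v , w) → φ v w) ∎

mult-flat : ∀ f → f 0 ≡ 1ℤ → ∀ u → mult f (flat u) ≡ mult f u
mult-flat f f0 []          = refl
mult-flat f f0 (zero ∷ u)  = trans (mult-flat f f0 u)
  (sym (trans (cong (_* mult f u) f0) (ℤₚ.*-identityˡ (mult f u))))
mult-flat f f0 (suc k ∷ u) = cong (f (suc k) *_) (mult-flat f f0 u)

weighted-flat : ∀ f k a Ψ → f 0 ≡ 1ℤ → (∀ w → Ψ (flat w) ≡ Ψ w) →
  ∀ u → weighted f k a Ψ (flat u) ≡ weighted f k a Ψ u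
weighted-flat f k a Ψ f0 inv = ∑-splits-flat _ (λ v w → cong₂ _*_
  (cong (λ n → ⟦ k ℕ.+ n ℕ.≡ᵇ a ⟧) (flat-sum v)) (cong₂ _*_ (mult-flat f f0 v) (inv w)))

Z-flat : ∀ y α u → Z y α (flat u) ≡ Z y α u
Z-flat y []      u           = mult-flat (linear 0ℤ) refl u
Z-flat y (a ∷ α) []          = refl
Z-flat y (a ∷ α) (zero ∷ u)  = Z-flat y (a ∷ α) u
Z-flat y (a ∷ α) (suc k ∷ u) =
  weighted-flat (constant⁺ y) (suc k) a (Z y α) refl (Z-flat y α) u

-- Homogeneity of `Z` and its value at y = 0

≡ᵇ-≢ : ∀ {m n} → ¬ m ≡ n → (m ℕ.≡ᵇ n) ≡ false
≡ᵇ-≢ {m} {n} m≢n with m ℕ.≡ᵇ n in eq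
... | true  = contradiction (ℕₚ.≡ᵇ⇒≡ m n (subst T (sym eq) _)) m≢n
... | false = refl

-- If the first row receives the right number of cells, the remaining word has the wrong size for
-- `α`. This settles words longer than the size of `α`, which exceed the range of labels in
-- `fillings`.
Z-graded : ∀ y α u → ¬ sum u ≡ sum α → Z y α u ≡ 0ℤ
Z-graded y []      []          ne = contradiction refl ne
Z-graded y []      (zero ∷ u)  ne = trans (ℤₚ.*-identityˡ (mult (linear 0ℤ) u)) (Z-graded y [] u ne)
Z-graded y []      (suc zero ∷ u) ne = refl
Z-graded y []      (suc (suc k) ∷ u) ne = refl
Z-graded y (a ∷ α) []          ne = refl
Z-graded y (a ∷ α) (zero ∷ u)  ne = Z-graded y (a ∷ α) u ne
Z-graded y (a ∷ α) (suc k ∷ u) ne = trans (∑-cong-All (splits-sum u) term)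
  (∑-zero (splits u) (λ _ → refl))
  where
  term : ∀ vw → sum (proj₁ vw) ℕ.+ sum (proj₂ vw) ≡ sum u →
    ⟦ suc k ℕ.+ sum (proj₁ vw) ℕ.≡ᵇ a ⟧ * (mult (constant⁺ y) (proj₁ vw) * Z y α (proj₂ vw)) ≡ 0ℤ
  term (v , w) eq with suc k ℕ.+ sum v ℕ.≟ a
  ... | no  k+v≢a = cong (λ b → ⟦ b ⟧ * (mult (constant⁺ y) v * Z y α w)) (≡ᵇ-≢ k+v≢a)
  ... | yes k+v≡a = trans (cong (λ e → ⟦ suc k ℕ.+ sum v ℕ.≡ᵇ a ⟧ * (mult (constant⁺ y) v * e))
          (Z-graded y α w (λ w≡α → ne (begin
            suc k ℕ.+ sum u                ≡⟨ cong (suc k ℕ.+_) eq ⟨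
            suc k ℕ.+ (sum v ℕ.+ sum w)    ≡⟨ ℕₚ.+-assoc (suc k) (sum v) (sum w) ⟨
            suc k ℕ.+ sum v ℕ.+ sum w      ≡⟨ cong₂ ℕ._+_ k+v≡a w≡α ⟩
            a ℕ.+ sum α                    ∎))))
          (trans (cong (⟦ suc k ℕ.+ sum v ℕ.≡ᵇ a ⟧ *_) (ℤₚ.*-zeroʳ (mult (constant⁺ y) v)))
                 (ℤₚ.*-zeroʳ ⟦ suc k ℕ.+ sum v ℕ.≡ᵇ a ⟧))

constant⁺-0 : ∀ b → constant⁺ 0ℤ b ≡ linear 0ℤ b
constant⁺-0 zero          = refl
constant⁺-0 (suc zero)    = refl
constant⁺-0 (suc (suc b)) = refl

-- At y = 0, that is q = 1, `constant⁺` degenerates to the unit: a row may hold one label only, so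
-- the head letter must be `a`.
Z-0 : ∀ α u → IsComposition u → Z 0ℤ α u ≡ ⟦ u == α ⟧
Z-0 []      []                cu = refl
Z-0 []      (suc zero ∷ u)    cu = refl
Z-0 []      (suc (suc k) ∷ u) cu = refl
Z-0 (a ∷ α) []                cu = refl
Z-0 (a ∷ α) (suc k ∷ u)       cu = begin
  weighted (constant⁺ 0ℤ) (suc k) a (Z 0ℤ α) u  ≡⟨ weighted-cong (suc k) a (Z 0ℤ α) u constant⁺-0 ⟩
  weighted (linear 0ℤ) (suc k) a (Z 0ℤ α) u     ≡⟨ weighted-linear-0 (suc k) a (Z 0ℤ α) u ⟩
  ⟦ suc k ℕ.≡ᵇ a ⟧ * Z 0ℤ α u                   ≡⟨ cong (⟦ suc k ℕ.≡ᵇ a ⟧ *_) (Z-0 α u cu) ⟩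
  ⟦ suc k ℕ.≡ᵇ a ⟧ * ⟦ u == α ⟧                 ≡⟨ ⟦∧⟧ (suc k ℕ.≡ᵇ a) (u == α) ⟨
  ⟦ (suc k ∷ u) == (a ∷ α) ⟧                    ∎

-- Stuffle multiplicities and sums over compositions

-- The branch of `comps` that enlarges the first part; the empty composition has no such branch,
-- hence the value 0.
raised : (Word → ℤ) → Word → ℤ
raised f []      = 0ℤ
raised f (a ∷ c) = f (suc a ∷ c)

∑-comps-suc : (f : Word → ℤ) (n : ℕ) → ∑ (comps (suc n)) f ≡
  ∑ (comps n) (λ c → f (1 ∷ c)) + ∑ (comps n) (raised f)
∑-comps-suc f n = trans (∑-concatMap f _ (comps n)) (trans (∑-cong (comps n) step) (∑-+ _ _ (comps n)))
  where
  step : ∀ c → _ ≡ f (1 ∷ c) + raised f c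
  step []      = trans (∑-[-] f _) (sym (ℤₚ.+-identityʳ (f (1 ∷ []))))
  step (a ∷ c) = trans (∑-∷ f _ _) (cong (_+_ (f (1 ∷ a ∷ c))) (∑-[-] f _))

All-concatMap : {A B : Set} {P : A → Set} {Q : B → Set} {h : A → List B} {xs : List A} →
  All P xs → (∀ x → P x → All Q (h x)) → All Q (concatMap h xs)
All-concatMap ps q = Allₚ.concat⁺ (Allₚ.map⁺ (All.map (q _) ps))

comps-composition : ∀ n → All (λ β → IsComposition β × sum β ≡ n) (comps n)
comps-composition zero    = (refl , refl) ∷ []
comps-composition (suc n) = All-concatMap (comps-composition n) λ where
  []          (p , eq) → (refl , cong suc eq) ∷ []
  (suc a ∷ c) (p , eq) → (p , cong suc eq) ∷ (p , cong suc eq) ∷ []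

-- `comps n` lists every composition of n exactly once: a head 1 arises only by prefixing, a larger
-- head only by raising.
∑-comps-pick : (G : Word → ℤ) (n : ℕ) (u : Word) → IsComposition u →
  ∑ (comps n) (λ β → ⟦ u == β ⟧ * G β) ≡ ⟦ n ℕ.≡ᵇ sum u ⟧ * G u
∑-comps-pick G zero    []          cu = ∑-[-] _ []
∑-comps-pick G zero    (suc k ∷ u) cu = ∑-[-] _ []
∑-comps-pick G (suc n) []          cu = trans (∑-comps-suc _ n)
  (cong₂ _+_ (∑-zero (comps n) (λ _ → refl)) (∑-zero (comps n) (λ { [] → refl ; (a ∷ c) → refl })))
∑-comps-pick G (suc n) (suc zero ∷ u) cu = trans (∑-comps-suc _ n)
  (trans (cong₂ _+_ (∑-comps-pick (λ c → G (1 ∷ c)) n u cu)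
    (trans (∑-cong-All (comps-composition n) vanish) (∑-zero (comps n) (λ _ → refl))))
    (ℤₚ.+-identityʳ (⟦ n ℕ.≡ᵇ sum u ⟧ * G (1 ∷ u))))
  where
  -- Parts of `c` are positive, so a raised head is at least 2 and never matches 1.
  vanish : ∀ c → IsComposition c × sum c ≡ n →
    raised (λ β → ⟦ (1 ∷ u) == β ⟧ * G β) c ≡ 0ℤ
  vanish []          _ = refl
  vanish (suc a ∷ c) _ = refl
∑-comps-pick G (suc n) (suc (suc k) ∷ u) cu = trans (∑-comps-suc _ n)
  (trans (cong₂ _+_ (∑-zero (comps n) (λ _ → refl)) (∑-cong (comps n) shift))
  (trans (ℤₚ.+-identityˡ (∑ (comps n) (λ β → ⟦ (suc k ∷ u) == β ⟧ * raised G β)))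
    (∑-comps-pick (raised G) n (suc k ∷ u) cu)))
  where
  shift : ∀ c → raised (λ β → ⟦ (suc (suc k) ∷ u) == β ⟧ * G β) c
    ≡ ⟦ (suc k ∷ u) == c ⟧ * raised G c
  shift []      = refl
  shift (a ∷ c) = refl

countIn-∑ : ∀ w xs → + countIn w xs ≡ ∑ xs (λ x → ⟦ w == x ⟧)
countIn-∑ w []       = sym (∑-[] _)
countIn-∑ w (x ∷ xs) = trans (step (w == x)) (sym (∑-∷ _ x xs))
  where
  step : ∀ b → + (if b then suc (countIn w xs) else countIn w xs) ≡ ⟦ b ⟧ + ∑ xs (λ x → ⟦ w == x ⟧)
  step true  = trans (ℤₚ.pos-+ 1 (countIn w xs)) (cong (_+_ 1ℤ) (countIn-∑ w xs))
  step false = trans (countIn-∑ w xs) (sym (ℤₚ.+-identityˡ _))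

∑-halves-pick : ∀ n c b → ∑ (halves n) (λ (i , j) → ⟦ i ℕ.≡ᵇ c ⟧ * ⟦ j ℕ.≡ᵇ b ⟧) ≡ ⟦ n ℕ.≡ᵇ c ℕ.+ b ⟧
∑-halves-pick zero    zero    b = trans (∑-halves-0 _) (ℤₚ.*-identityˡ ⟦ 0 ℕ.≡ᵇ b ⟧)
∑-halves-pick zero    (suc c) b = ∑-halves-0 _
∑-halves-pick (suc n) zero    b = trans (∑-halves-suc _ n)
  (trans (cong₂ _+_ (ℤₚ.*-identityˡ ⟦ suc n ℕ.≡ᵇ b ⟧) (∑-zero (halves n) (λ _ → refl)))
    (ℤₚ.+-identityʳ ⟦ suc n ℕ.≡ᵇ b ⟧))
∑-halves-pick (suc n) (suc c) b = trans (∑-halves-suc _ n)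
  (trans (ℤₚ.+-identityˡ _) (∑-halves-pick n c b))

flat-fixed : ∀ u → IsComposition u → flat u ≡ u
flat-fixed []          cu = refl
flat-fixed (suc k ∷ u) cu = cong (suc k ∷_) (flat-fixed u cu)

flat-==-[] : ∀ u → ⟦ flat u == [] ⟧ ≡ mult (linear 0ℤ) u
flat-==-[] []                = refl
flat-==-[] (zero ∷ u)        = trans (flat-==-[] u) (sym (ℤₚ.*-identityˡ (mult (linear 0ℤ) u)))
flat-==-[] (suc zero ∷ u)    = refl
flat-==-[] (suc (suc k) ∷ u) = refl

-- The three kinds of stuffle terms, with head c, b or c + b, correspond to splitting the head
-- letter as (c, 0), (0, b) or (c, b). Deleting the zeros of the two halves recovers `γ` and `β`.
stuffle-splits : ∀ w γ β → IsComposition w → IsComposition γ → IsComposition β →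
  ∑ (qsh γ β) (λ x → ⟦ w == x ⟧) ≡ ∑ (splits w) (λ (v , v′) → ⟦ flat v == γ ⟧ * ⟦ flat v′ == β ⟧)
stuffle-splits w [] β cw cγ cβ = begin
  ∑ (β ∷ []) (λ x → ⟦ w == x ⟧)
    ≡⟨ ∑-[-] _ β ⟩
  ⟦ w == β ⟧
    ≡⟨ cong (λ u → ⟦ u == β ⟧) (flat-fixed w cw) ⟨
  ⟦ flat w == β ⟧
    ≡⟨ ∑-splits-linear-0 (λ _ u → ⟦ flat u == β ⟧) w ⟨
  ∑ (splits w) (λ (v , v′) → mult (linear 0ℤ) v * ⟦ flat v′ == β ⟧)
    ≡⟨ ∑-cong (splits w) (λ (v , v′) → cong (_* ⟦ flat v′ == β ⟧) (flat-==-[] v)) ⟨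
  ∑ (splits w) (λ (v , v′) → ⟦ flat v == [] ⟧ * ⟦ flat v′ == β ⟧) ∎
stuffle-splits [] (suc c ∷ γ) [] cw cγ cβ = trans (∑-[-] _ (suc c ∷ γ)) (sym (∑-splits-[] _))
stuffle-splits (suc a ∷ w) (suc c ∷ γ) [] cw cγ cβ = begin
  ∑ ((suc c ∷ γ) ∷ []) (λ x → ⟦ (suc a ∷ w) == x ⟧)
    ≡⟨ ∑-[-] _ (suc c ∷ γ) ⟩
  ⟦ (a ℕ.≡ᵇ c) ∧ (w == γ) ⟧
    ≡⟨ ⟦∧⟧ (a ℕ.≡ᵇ c) (w == γ) ⟩
  ⟦ a ℕ.≡ᵇ c ⟧ * ⟦ w == γ ⟧
    ≡⟨ cong₂ _*_ (trans (∑-halves-pick (suc a) (suc c) 0) (cong (λ e → ⟦ a ℕ.≡ᵇ e ⟧) (ℕₚ.+-identityʳ c)))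
         (sym w==γ) ⟨
  ∑ (halves (suc a)) (λ (i , j) → ⟦ i ℕ.≡ᵇ suc c ⟧ * ⟦ j ℕ.≡ᵇ 0 ⟧) * K
    ≡⟨ ∑-*ʳ K _ (halves (suc a)) ⟨
  ∑ (halves (suc a)) (λ (i , j) → ⟦ i ℕ.≡ᵇ suc c ⟧ * ⟦ j ℕ.≡ᵇ 0 ⟧ * K)
    ≡⟨ ∑-cong-All (halves-sum (suc a)) (λ (i , j) → term i j) ⟨
  ∑ (halves (suc a)) (λ (i , j) → ∑ (splits w) (λ (v , v′) →
    ⟦ flat (i ∷ v) == (suc c ∷ γ) ⟧ * ⟦ flat (j ∷ v′) == [] ⟧))
    ≡⟨ ∑-splits-∷ _ (suc a) w ⟨
  ∑ (splits (suc a ∷ w)) (λ (v , v′) → ⟦ flat v == (suc c ∷ γ) ⟧ * ⟦ flat v′ == [] ⟧) ∎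
  where
  K : ℤ
  K = ∑ (splits w) (λ (v , v′) → ⟦ flat v == γ ⟧ * ⟦ flat v′ == [] ⟧)
  w==γ : ⟦ w == γ ⟧ ≡ K
  w==γ = trans (sym (count-[] γ)) (stuffle-splits w γ [] cw cγ refl)
    where
    count-[] : ∀ γ → ∑ (qsh γ []) (λ x → ⟦ w == x ⟧) ≡ ⟦ w == γ ⟧
    count-[] []      = ∑-[-] _ []
    count-[] (c ∷ γ) = ∑-[-] _ (c ∷ γ)
  term : ∀ i j → i ℕ.+ j ≡ suc a → ∑ (splits w) (λ (v , v′) →
    ⟦ flat (i ∷ v) == (suc c ∷ γ) ⟧ * ⟦ flat (j ∷ v′) == [] ⟧) ≡ ⟦ i ℕ.≡ᵇ suc c ⟧ * ⟦ j ℕ.≡ᵇ 0 ⟧ * K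
  term zero    (suc j) _ = ∑-zero (splits w) (λ (v , v′) → ℤₚ.*-zeroʳ ⟦ flat v == (suc c ∷ γ) ⟧)
  term (suc i) zero    _ = trans
    (∑-cong (splits w) (λ (v , v′) → trans
      (cong (_* ⟦ flat v′ == [] ⟧) (⟦∧⟧ (i ℕ.≡ᵇ c) (flat v == γ)))
      (trans (ℤₚ.*-assoc ⟦ i ℕ.≡ᵇ c ⟧ ⟦ flat v == γ ⟧ ⟦ flat v′ == [] ⟧)
        (cong (_* (⟦ flat v == γ ⟧ * ⟦ flat v′ == [] ⟧)) (sym (ℤₚ.*-identityʳ ⟦ i ℕ.≡ᵇ c ⟧))))))
    (∑-*ˡ (⟦ i ℕ.≡ᵇ c ⟧ * 1ℤ) _ (splits w))
  term (suc i) (suc j) _ = trans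
    (∑-zero (splits w) (λ (v , v′) → ℤₚ.*-zeroʳ ⟦ flat (suc i ∷ v) == (suc c ∷ γ) ⟧))
    (sym (cong (_* K) (ℤₚ.*-zeroʳ ⟦ i ℕ.≡ᵇ c ⟧)))
stuffle-splits [] (suc c ∷ γ) (suc b ∷ β) cw cγ cβ = trans
  (trans (∑-++ _ (map (suc c ∷_) (qsh γ (suc b ∷ β))) _)
    (cong₂ _+_ (none (suc c) (qsh γ (suc b ∷ β)))
      (trans (∑-++ _ (map (suc b ∷_) (qsh (suc c ∷ γ) β)) _)
        (cong₂ _+_ (none (suc b) (qsh (suc c ∷ γ) β)) (none (suc c ℕ.+ suc b) (qsh γ β))))))
  (sym (∑-splits-[] _))
  where
  none : ∀ x L → ∑ (map (x ∷_) L) (λ y → ⟦ [] == y ⟧) ≡ 0ℤ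
  none x L = trans (∑-map _ (x ∷_) L) (∑-zero L (λ _ → refl))
stuffle-splits (suc a ∷ w) (suc c ∷ γ) (suc b ∷ β) cw cγ cβ = begin
  ∑ (qsh (suc c ∷ γ) (suc b ∷ β)) (λ x → ⟦ (suc a ∷ w) == x ⟧)
    ≡⟨ trans (∑-++ _ (map (suc c ∷_) (qsh γ (suc b ∷ β))) _)
        (cong (_+_ (∑ (map (suc c ∷_) (qsh γ (suc b ∷ β))) (λ x → ⟦ (suc a ∷ w) == x ⟧)))
          (∑-++ _ (map (suc b ∷_) (qsh (suc c ∷ γ) β)) _)) ⟩
  ∑ (map (suc c ∷_) (qsh γ (suc b ∷ β))) (λ x → ⟦ (suc a ∷ w) == x ⟧)
    + (∑ (map (suc b ∷_) (qsh (suc c ∷ γ) β)) (λ x → ⟦ (suc a ∷ w) == x ⟧)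
    + ∑ (map (suc c ℕ.+ suc b ∷_) (qsh γ β)) (λ x → ⟦ (suc a ∷ w) == x ⟧))
    ≡⟨ cong₂ _+_ (part (suc c) (stuffle-splits w γ (suc b ∷ β) cw cγ cβ))
        (cong₂ _+_ (part (suc b) (stuffle-splits w (suc c ∷ γ) β cw cγ cβ))
          (part (suc c ℕ.+ suc b) (stuffle-splits w γ β cw cγ cβ))) ⟩
  ⟦ suc a ℕ.≡ᵇ suc c ⟧ * K₁ + (⟦ suc a ℕ.≡ᵇ suc b ⟧ * K₂ + ⟦ suc a ℕ.≡ᵇ suc c ℕ.+ suc b ⟧ * K₃)
    ≡⟨ cong₂ _+_
         (cong (_* K₁) (trans (∑-halves-pick (suc a) (suc c) 0) (cong (λ e → ⟦ a ℕ.≡ᵇ e ⟧) (ℕₚ.+-identityʳ c))))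
         (cong₂ _+_ (cong (_* K₂) (∑-halves-pick (suc a) 0 (suc b)))
           (cong (_* K₃) (∑-halves-pick (suc a) (suc c) (suc b)))) ⟨
  ∑ H (p (suc c) 0) * K₁ + (∑ H (p 0 (suc b)) * K₂ + ∑ H (p (suc c) (suc b)) * K₃)
    ≡⟨ trans (∑-+ _ _ H) (cong₂ _+_ (∑-*ʳ K₁ (p (suc c) 0) H)
         (trans (∑-+ _ _ H) (cong₂ _+_ (∑-*ʳ K₂ (p 0 (suc b)) H) (∑-*ʳ K₃ (p (suc c) (suc b)) H)))) ⟨
  ∑ H (λ ij → p (suc c) 0 ij * K₁ + (p 0 (suc b) ij * K₂ + p (suc c) (suc b) ij * K₃))
    ≡⟨ ∑-cong-All (halves-sum (suc a)) (λ (i , j) → term i j) ⟨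
  ∑ H (λ (i , j) → ∑ (splits w) (λ (v , v′) →
    ⟦ flat (i ∷ v) == (suc c ∷ γ) ⟧ * ⟦ flat (j ∷ v′) == (suc b ∷ β) ⟧))
    ≡⟨ ∑-splits-∷ _ (suc a) w ⟨
  ∑ (splits (suc a ∷ w)) (λ (v , v′) → ⟦ flat v == (suc c ∷ γ) ⟧ * ⟦ flat v′ == (suc b ∷ β) ⟧) ∎
  where
  H : List (ℕ × ℕ)
  H = halves (suc a)
  p : ℕ → ℕ → ℕ × ℕ → ℤ
  p k l (i , j) = ⟦ i ℕ.≡ᵇ k ⟧ * ⟦ j ℕ.≡ᵇ l ⟧
  K₁ K₂ K₃ : ℤ
  K₁ = ∑ (splits w) (λ (v , v′) → ⟦ flat v == γ ⟧ * ⟦ flat v′ == (suc b ∷ β) ⟧)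
  K₂ = ∑ (splits w) (λ (v , v′) → ⟦ flat v == (suc c ∷ γ) ⟧ * ⟦ flat v′ == β ⟧)
  K₃ = ∑ (splits w) (λ (v , v′) → ⟦ flat v == γ ⟧ * ⟦ flat v′ == β ⟧)
  part : ∀ x {L K} → ∑ L (λ y → ⟦ w == y ⟧) ≡ K →
    ∑ (map (x ∷_) L) (λ y → ⟦ (suc a ∷ w) == y ⟧) ≡ ⟦ suc a ℕ.≡ᵇ x ⟧ * K
  part x {L} eq = trans (∑-map _ (x ∷_) L)
    (trans (∑-cong L (λ y → ⟦∧⟧ (suc a ℕ.≡ᵇ x) (w == y)))
    (trans (∑-*ˡ ⟦ suc a ℕ.≡ᵇ x ⟧ _ L) (cong (⟦ suc a ℕ.≡ᵇ x ⟧ *_) eq)))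
  pull : ∀ q (r s : Word × Word → Bool) →
    ∑ (splits w) (λ x → ⟦ r x ⟧ * ⟦ q ∧ s x ⟧) ≡ ⟦ q ⟧ * ∑ (splits w) (λ x → ⟦ r x ⟧ * ⟦ s x ⟧)
  pull q r s = trans (∑-cong (splits w) (λ x → trans (cong (⟦ r x ⟧ *_) (⟦∧⟧ q (s x)))
      (x∙yz≈y∙xz ⟦ r x ⟧ ⟦ q ⟧ ⟦ s x ⟧)))
    (∑-*ˡ ⟦ q ⟧ _ (splits w))
  pull′ : ∀ q (r s : Word × Word → Bool) →
    ∑ (splits w) (λ x → ⟦ q ∧ r x ⟧ * ⟦ s x ⟧) ≡ ⟦ q ⟧ * ∑ (splits w) (λ x → ⟦ r x ⟧ * ⟦ s x ⟧)
  pull′ q r s = trans (∑-cong (splits w) (λ x → trans (cong (_* ⟦ s x ⟧) (⟦∧⟧ q (r x)))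
      (ℤₚ.*-assoc ⟦ q ⟧ ⟦ r x ⟧ ⟦ s x ⟧)))
    (∑-*ˡ ⟦ q ⟧ _ (splits w))
  -- The pair (0, 0) is excluded by the sum. For every other pair, which of `i` and `j` vanish
  -- decides the one among the three terms that can be non-zero.
  term : ∀ i j → i ℕ.+ j ≡ suc a → ∑ (splits w) (λ (v , v′) →
    ⟦ flat (i ∷ v) == (suc c ∷ γ) ⟧ * ⟦ flat (j ∷ v′) == (suc b ∷ β) ⟧)
    ≡ p (suc c) 0 (i , j) * K₁ + (p 0 (suc b) (i , j) * K₂ + p (suc c) (suc b) (i , j) * K₃)
  term zero    (suc j) _ = trans (pull (j ℕ.≡ᵇ b) (λ (v , _) → flat v == (suc c ∷ γ)) (λ (_ , v′) → flat v′ == β)) (rearrange ⟦ j ℕ.≡ᵇ b ⟧ K₁ K₂ K₃)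
    where
    rearrange : ∀ x k₁ k₂ k₃ → x * k₂ ≡ 0ℤ * k₁ + (1ℤ * x * k₂ + 0ℤ * k₃)
    rearrange = solve-∀
  term (suc i) zero    _ = trans (pull′ (i ℕ.≡ᵇ c) (λ (v , _) → flat v == γ) (λ (_ , v′) → flat v′ == (suc b ∷ β))) (rearrange ⟦ i ℕ.≡ᵇ c ⟧ K₁ K₂ K₃)
    where
    rearrange : ∀ x k₁ k₂ k₃ → x * k₁ ≡ x * 1ℤ * k₁ + (0ℤ * k₂ + x * 0ℤ * k₃)
    rearrange = solve-∀
  term (suc i) (suc j) _ = trans (pull′ (i ℕ.≡ᵇ c) (λ (v , _) → flat v == γ) (λ (_ , v′) → flat (suc j ∷ v′) == (suc b ∷ β)))
    (trans (cong (⟦ i ℕ.≡ᵇ c ⟧ *_) (pull (j ℕ.≡ᵇ b) (λ (v , _) → flat v == γ) (λ (_ , v′) → flat v′ == β)))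
      (rearrange ⟦ i ℕ.≡ᵇ c ⟧ ⟦ j ℕ.≡ᵇ b ⟧ K₁ K₂ K₃))
    where
    rearrange : ∀ x y k₁ k₂ k₃ → x * (y * k₃) ≡ x * 0ℤ * k₁ + (0ℤ * k₂ + x * y * k₃)
    rearrange = solve-∀

-- Evaluation at q = x, and the adjoints of B_m and B~_m

eval-⊕ : ∀ x p r → eval x (p ⊕ r) ≡ eval x p + eval x r
eval-⊕ x []      r       = sym (ℤₚ.+-identityˡ (eval x r))
eval-⊕ x (a ∷ p) []      = sym (ℤₚ.+-identityʳ (eval x (a ∷ p)))
eval-⊕ x (a ∷ p) (b ∷ r) = trans (cong (λ e → a + b + x * e) (eval-⊕ x p r))
  (rearrange a b x (eval x p) (eval x r))
  where
  rearrange : ∀ a b x s t → a + b + x * (s + t) ≡ a + x * s + (b + x * t)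
  rearrange = solve-∀

eval-scalar : ∀ x a r → eval x (scalar a r) ≡ a * eval x r
eval-scalar x a []      = sym (ℤₚ.*-zeroʳ a)
eval-scalar x a (b ∷ r) = trans (cong (λ e → a * b + x * e) (eval-scalar x a r))
  (rearrange a b x (eval x r))
  where
  rearrange : ∀ a b x s → a * b + x * (a * s) ≡ a * (b + x * s)
  rearrange = solve-∀

eval-⊗ : ∀ x p r → eval x (p ⊗ r) ≡ eval x p * eval x r
eval-⊗ x []      r = refl
eval-⊗ x (a ∷ p) r = begin
  eval x (scalar a r ⊕ (+ 0 ∷ p ⊗ r))           ≡⟨ eval-⊕ x (scalar a r) (+ 0 ∷ p ⊗ r) ⟩
  eval x (scalar a r) + (0ℤ + x * eval x (p ⊗ r)) ≡⟨ cong₂ (λ s t → s + (0ℤ + x * t)) (eval-scalar x a r) (eval-⊗ x p r) ⟩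
  a * eval x r + (0ℤ + x * (eval x p * eval x r)) ≡⟨ rearrange a x (eval x p) (eval x r) ⟩
  (a + x * eval x p) * eval x r                 ∎
  where
  rearrange : ∀ a x s t → a * t + (0ℤ + x * (s * t)) ≡ (a + x * s) * t
  rearrange = solve-∀

eval-neg : ∀ x p → eval x (negₚ p) ≡ - eval x p
eval-neg x []      = refl
eval-neg x (a ∷ p) = trans (cong (λ e → - a + x * e) (eval-neg x p)) (rearrange a x (eval x p))
  where
  rearrange : ∀ a x s → - a + x * - s ≡ - (a + x * s)
  rearrange = solve-∀

eval-const : ∀ x a → eval x (const a) ≡ a
eval-const x a = trans (cong (_+_ a) (ℤₚ.*-zeroʳ x)) (ℤₚ.+-identityʳ a)

eval-^ₚ : ∀ x p n → eval x (p ^ₚ n) ≡ eval x p ℤ.^ n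
eval-^ₚ x p zero    = eval-const x 1ℤ
eval-^ₚ x p (suc n) = trans (eval-⊗ x p (p ^ₚ n)) (cong (eval x p *_) (eval-^ₚ x p n))

eval-qₚ : ∀ x → eval x qₚ ≡ x
eval-qₚ = lemma
  where
  lemma : ∀ x → 0ℤ + x * (1ℤ + x * 0ℤ) ≡ x
  lemma = solve-∀

eval-sign : ∀ x i → eval x (sign i) ≡ -1ℤ ℤ.^ i
eval-sign x zero    = eval-const x 1ℤ
eval-sign x (suc i) = trans (eval-neg x (sign i)) (trans (cong -_ (eval-sign x i))
  (sym (ℤₚ.-1*i≡-i (-1ℤ ℤ.^ i))))

-- ev x f G is the pairing at q = x of f with Σ_w G(w) M_w.
ev : ℤ → Lin → (Word → ℤ) → ℤ
ev x f G = ∑ f (λ (c , w) → eval x c * G w)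

-- The stuffle counts are computed at compositions only, and at words with a zero letter `Rhs` has
-- coefficient 0 while `Z` ignores the zero. This predicate keeps the supports away from such words.
Composed : Lin → Set
Composed = All (λ (c , w) → IsComposition w)

ev-cong : ∀ x {f G G′} → Composed f → (∀ w → IsComposition w → G w ≡ G′ w) → ev x f G ≡ ev x f G′
ev-cong x cf eq = ∑-cong-All cf (λ (c , w) cw → cong (eval x c *_) (eq w cw))

ev-scaleL : ∀ x p f G → ev x (scaleL p f) G ≡ eval x p * ev x f G
ev-scaleL x p f G = trans (∑-map _ _ f) (trans
  (∑-cong f (λ (c , w) → trans (cong (_* G w) (eval-⊗ x p c)) (ℤₚ.*-assoc (eval x p) (eval x c) (G w))))
  (∑-*ˡ (eval x p) _ f))

ev-hL : ∀ x k f G → ev x (hL (suc k) f) G ≡ ev x f (λ w → G (suc k ∷ w))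
ev-hL x k f G = trans (∑-map _ _ f) (∑-cong f (λ _ → refl))

All-⊤ : {A : Set} (xs : List A) → All (λ _ → ⊤) xs
All-⊤ = All.universal (λ _ → tt)

perpM-composed : ∀ γ f → Composed (perpM γ f)
perpM-composed γ f = All-concatMap (All-⊤ f) λ (c , w) _ →
  Allₚ.map⁺ (All.map proj₁ (comps-composition (size w ∸ size γ)))

perpF-composed : ∀ i f → Composed (perpF i f)
perpF-composed i f = All-concatMap (comps-composition i) (λ γ _ → perpM-composed γ f)

hL-composed : ∀ k f → Composed f → Composed (hL (suc k) f)
hL-composed k f cf = Allₚ.map⁺ cf

scaleL-composed : ∀ p f → Composed f → Composed (scaleL p f)
scaleL-composed p f cf = Allₚ.map⁺ cf

B-composed : ∀ m f → Composed (B (suc m) f)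
B-composed m f = All-concatMap (All-⊤ f) λ (c , w) _ →
  All-concatMap (All-⊤ (upTo (suc (size w)))) λ i _ →
  scaleL-composed (sign i) _ (hL-composed (m ℕ.+ i) _ (perpM-composed (replicate i 1) ((c , w) ∷ [])))

Bt-composed : ∀ m f → Composed (Bt (suc m) f)
Bt-composed m f = All-concatMap (All-⊤ f) λ (c , w) _ →
  All-concatMap (All-⊤ (upTo (suc (size w)))) λ i _ →
  scaleL-composed (qₚ ^ₚ i) _ (B-composed (m ℕ.+ i) (perpF i ((c , w) ∷ [])))

≡ᵇ-refl : ∀ n → (n ℕ.≡ᵇ n) ≡ true
≡ᵇ-refl zero    = refl
≡ᵇ-refl (suc n) = ≡ᵇ-refl n

==-sound : ∀ u v → (u == v) ≡ true → u ≡ v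
==-sound u v with ≡-dec ℕ._≟_ u v
... | yes eq = λ _ → eq
... | no  _  = λ ()

ev-perpM-∑ : ∀ x γ f G → ev x (perpM γ f) G ≡ ∑ f (λ (c , w) →
  ∑ (comps (size w ∸ size γ)) (λ β → eval x (c ⊗ const (+ countIn w (qsh γ β))) * G β))
ev-perpM-∑ x γ f G = trans (∑-concatMap _ _ f) (∑-cong f (λ (c , w) →
  ∑-map _ (λ β → (c ⊗ const (+ countIn w (qsh γ β)) , β)) (comps (size w ∸ size γ))))

-- `stuffle-splits` turns the multiplicities into splittings of `w`, after which the sum over β
-- retains only `flat v′`. The right side is the coefficient at `w` of M_γ times the function `G`.
ev-perpM : ∀ x γ c w G → IsComposition w → IsComposition γ →
  ev x (perpM γ ((c , w) ∷ [])) G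
  ≡ eval x c * ∑ (splits w) (λ (v , v′) → ⟦ flat v == γ ⟧ * G (flat v′))
ev-perpM x γ c w G cw cγ = begin
  ev x (perpM γ ((c , w) ∷ [])) G
    ≡⟨ trans (ev-perpM-∑ x γ ((c , w) ∷ []) G) (∑-[-] _ (c , w)) ⟩
  ∑ (comps n) (λ β → eval x (c ⊗ const (+ countIn w (qsh γ β))) * G β)
    ≡⟨ ∑-cong-All (comps-composition n) (λ β (cβ , _) → begin
         eval x (c ⊗ const (+ countIn w (qsh γ β))) * G β
           ≡⟨ cong (_* G β) (trans (eval-⊗ x c _) (cong (eval x c *_) (eval-const x _))) ⟩
         eval x c * (+ countIn w (qsh γ β)) * G β
           ≡⟨ ℤₚ.*-assoc (eval x c) _ (G β) ⟩
         eval x c * ((+ countIn w (qsh γ β)) * G β)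
           ≡⟨ cong (λ e → eval x c * (e * G β))
                (trans (countIn-∑ w (qsh γ β)) (stuffle-splits w γ β cw cγ cβ)) ⟩
         eval x c * (∑ (splits w) (λ (v , v′) → ⟦ flat v == γ ⟧ * ⟦ flat v′ == β ⟧) * G β)
           ≡⟨ cong (eval x c *_) (∑-*ʳ (G β) (λ (v , v′) → ⟦ flat v == γ ⟧ * ⟦ flat v′ == β ⟧) (splits w)) ⟨
         eval x c * ∑ (splits w) (λ (v , v′) → ⟦ flat v == γ ⟧ * ⟦ flat v′ == β ⟧ * G β) ∎) ⟩
  ∑ (comps n) (λ β → eval x c * ∑ (splits w) (λ (v , v′) → ⟦ flat v == γ ⟧ * ⟦ flat v′ == β ⟧ * G β))
    ≡⟨ trans (∑-*ˡ (eval x c) _ (comps n)) (cong (eval x c *_) (∑-swap _ (comps n) (splits w))) ⟩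
  eval x c * ∑ (splits w) (λ (v , v′) → ∑ (comps n) (λ β → ⟦ flat v == γ ⟧ * ⟦ flat v′ == β ⟧ * G β))
    ≡⟨ cong (eval x c *_) (∑-cong-All (splits-sum w) (λ (v , v′) eq → trans
         (∑-cong (comps n) (λ β → ℤₚ.*-assoc ⟦ flat v == γ ⟧ ⟦ flat v′ == β ⟧ (G β)))
         (trans (∑-*ˡ ⟦ flat v == γ ⟧ _ (comps n))
           -- The compositions summed over have size |w| - |γ|, which is known to be `sum v′` only
           -- when `flat v` is `γ`; `⟦⟧*-cong` hands this equation to `pick`.
           (⟦⟧*-cong (flat v == γ) (pick v v′ eq))))) ⟩
  eval x c * ∑ (splits w) (λ (v , v′) → ⟦ flat v == γ ⟧ * G (flat v′)) ∎
  where
  n : ℕ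
  n = size w ∸ size γ
  pick : ∀ v v′ → sum v ℕ.+ sum v′ ≡ sum w → (flat v == γ) ≡ true →
    ∑ (comps n) (λ β → ⟦ flat v′ == β ⟧ * G β) ≡ G (flat v′)
  pick v v′ eq v≡γ = begin
    ∑ (comps n) (λ β → ⟦ flat v′ == β ⟧ * G β)
      ≡⟨ ∑-comps-pick G n (flat v′) (flat-composition v′) ⟩
    ⟦ n ℕ.≡ᵇ sum (flat v′) ⟧ * G (flat v′)
      ≡⟨ cong (λ b → ⟦ b ⟧ * G (flat v′)) (trans (cong (n ℕ.≡ᵇ_) sum≡) (≡ᵇ-refl n)) ⟩
    1ℤ * G (flat v′)
      ≡⟨ ℤₚ.*-identityˡ (G (flat v′)) ⟩
    G (flat v′) ∎
    where
    sum≡ : sum (flat v′) ≡ n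
    sum≡ = sym (begin
      sum w ∸ sum γ                  ≡⟨ cong₂ _∸_ eq (trans (sym (flat-sum v)) (cong sum (==-sound (flat v) γ v≡γ))) ⟨
      sum v ℕ.+ sum v′ ∸ sum v       ≡⟨ ℕₚ.m+n∸m≡n (sum v) (sum v′) ⟩
      sum v′                         ≡⟨ flat-sum v′ ⟨
      sum (flat v′)                  ∎)

-- This is Σ_i (-1)^i e_i · R_{m+i} G: `mult (linear -1ℤ) v` is (-1)^i when the letters of `v` are
-- at most 1 with sum i, and 0 when a letter is larger. The index i is thus read off as `sum v`.
B* : ℕ → (Word → ℤ) → Word → ℤ
B* m G w = ∑ (splits w) (λ (v , v′) → mult (linear -1ℤ) v * G (m ℕ.+ sum v ∷ flat v′))

-- Every word of sum i has coefficient 1 in F_i, so the factor x^i F_i becomes `x ℤ.^ sum v` with no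
-- condition on `v`.
Bt* : ℤ → ℕ → (Word → ℤ) → Word → ℤ
Bt* x m G w = ∑ (splits w) (λ (v , v′) → x ℤ.^ sum v * B* (m ℕ.+ sum v) G (flat v′))

replicate-composition : ∀ i → IsComposition (replicate i 1)
replicate-composition zero    = refl
replicate-composition (suc i) = replicate-composition i

-- A word flattens to 1^i exactly when its letters are at most 1 and have sum i. This ties the
-- summation index of B_m to `sum v`, so that the sum over i collapses.
flat-==-ones : ∀ v i → -1ℤ ℤ.^ i * ⟦ flat v == replicate i 1 ⟧ ≡ ⟦ i ℕ.≡ᵇ sum v ⟧ * mult (linear -1ℤ) v
flat-==-ones []                zero    = refl
flat-==-ones []                (suc i) = ℤₚ.*-zeroʳ (-1ℤ ℤ.^ suc i)
flat-==-ones (zero ∷ v)        i       = trans (flat-==-ones v i)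
  (cong (⟦ i ℕ.≡ᵇ sum v ⟧ *_) (sym (ℤₚ.*-identityˡ (mult (linear -1ℤ) v))))
flat-==-ones (suc zero ∷ v)    zero    = refl
flat-==-ones (suc zero ∷ v)    (suc i) = begin
  -1ℤ * -1ℤ ℤ.^ i * ⟦ flat v == replicate i 1 ⟧     ≡⟨ ℤₚ.*-assoc -1ℤ (-1ℤ ℤ.^ i) ⟦ flat v == replicate i 1 ⟧ ⟩
  -1ℤ * (-1ℤ ℤ.^ i * ⟦ flat v == replicate i 1 ⟧)   ≡⟨ cong (-1ℤ *_) (flat-==-ones v i) ⟩
  -1ℤ * (⟦ i ℕ.≡ᵇ sum v ⟧ * mult (linear -1ℤ) v)    ≡⟨ x∙yz≈y∙xz -1ℤ ⟦ i ℕ.≡ᵇ sum v ⟧ (mult (linear -1ℤ) v) ⟩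
  ⟦ i ℕ.≡ᵇ sum v ⟧ * (-1ℤ * mult (linear -1ℤ) v)    ∎
flat-==-ones (suc (suc k) ∷ v) zero    = refl
flat-==-ones (suc (suc k) ∷ v) (suc i) = trans (ℤₚ.*-zeroʳ (-1ℤ ℤ.^ suc i))
  (sym (ℤₚ.*-zeroʳ ⟦ i ℕ.≡ᵇ suc k ℕ.+ sum v ⟧))

ev-B : ∀ x m f G → Composed f → ev x (B (suc m) f) G ≡ ev x f (B* (suc m) G)
ev-B x m f G cf = trans (∑-concatMap _ _ f) (∑-cong-All cf term)
  where
  term : ∀ cw → IsComposition (proj₂ cw) → _ ≡ eval x (proj₁ cw) * B* (suc m) G (proj₂ cw)
  term (c , w) pw = begin
    ∑ (concatMap (λ i → scaleL (sign i) (hL (suc m ℕ.+ i) (perpE i ((c , w) ∷ [])))) (upTo (suc (size w))))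
      (λ (d , u) → eval x d * G u)
      ≡⟨ ∑-concatMap _ _ (upTo (suc (size w))) ⟩
    ∑ (upTo (suc (size w))) (λ i → ev x (scaleL (sign i) (hL (suc m ℕ.+ i) (perpE i ((c , w) ∷ [])))) G)
      ≡⟨ ∑-cong (upTo (suc (size w))) inner ⟩
    ∑ (upTo (suc (size w))) (λ i → eval x c * ∑ (splits w) (λ (v , v′) →
      ⟦ i ℕ.≡ᵇ sum v ⟧ * (mult (linear -1ℤ) v * G (suc m ℕ.+ i ∷ flat v′))))
      ≡⟨ trans (∑-*ˡ (eval x c) _ (upTo (suc (size w))))
           (cong (eval x c *_) (∑-swap _ (upTo (suc (size w))) (splits w))) ⟩
    eval x c * ∑ (splits w) (λ (v , v′) → ∑ (upTo (suc (size w))) (λ i →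
      ⟦ i ℕ.≡ᵇ sum v ⟧ * (mult (linear -1ℤ) v * G (suc m ℕ.+ i ∷ flat v′))))
      -- The surviving index `sum v` is at most `size w`, hence within the truncated range of i.
      ≡⟨ cong (eval x c *_) (∑-cong-All (splits-sum w) (λ (v , v′) eq →
           ∑-upTo-pick (λ i → mult (linear -1ℤ) v * G (suc m ℕ.+ i ∷ flat v′)) (suc (size w)) (sum v)
             (s≤s (subst (sum v ≤_) eq (ℕₚ.m≤m+n (sum v) (sum v′)))))) ⟩
    eval x c * B* (suc m) G w ∎
    where
    inner : ∀ i → ev x (scaleL (sign i) (hL (suc m ℕ.+ i) (perpE i ((c , w) ∷ [])))) G
      ≡ eval x c * ∑ (splits w) (λ (v , v′) →
          ⟦ i ℕ.≡ᵇ sum v ⟧ * (mult (linear -1ℤ) v * G (suc m ℕ.+ i ∷ flat v′)))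
    inner i = begin
      ev x (scaleL (sign i) (hL (suc m ℕ.+ i) (perpE i ((c , w) ∷ [])))) G
        ≡⟨ ev-scaleL x (sign i) (hL (suc m ℕ.+ i) (perpE i ((c , w) ∷ []))) G ⟩
      eval x (sign i) * ev x (hL (suc m ℕ.+ i) (perpE i ((c , w) ∷ []))) G
        ≡⟨ cong₂ _*_ (eval-sign x i) (trans (ev-hL x (m ℕ.+ i) (perpE i ((c , w) ∷ [])) G)
             (ev-perpM x (replicate i 1) c w (λ u → G (suc m ℕ.+ i ∷ u)) pw (replicate-composition i))) ⟩
      -1ℤ ℤ.^ i * (eval x c * ∑ (splits w) (λ (v , v′) →
        ⟦ flat v == replicate i 1 ⟧ * G (suc m ℕ.+ i ∷ flat v′)))
        ≡⟨ trans (x∙yz≈y∙xz (-1ℤ ℤ.^ i) (eval x c) _)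
             (cong (eval x c *_) (sym (∑-*ˡ (-1ℤ ℤ.^ i) _ (splits w)))) ⟩
      eval x c * ∑ (splits w) (λ (v , v′) →
        -1ℤ ℤ.^ i * (⟦ flat v == replicate i 1 ⟧ * G (suc m ℕ.+ i ∷ flat v′)))
        ≡⟨ cong (eval x c *_) (∑-cong (splits w) (λ (v , v′) → begin
             -1ℤ ℤ.^ i * (⟦ flat v == replicate i 1 ⟧ * G (suc m ℕ.+ i ∷ flat v′))
               ≡⟨ ℤₚ.*-assoc (-1ℤ ℤ.^ i) ⟦ flat v == replicate i 1 ⟧ _ ⟨
             -1ℤ ℤ.^ i * ⟦ flat v == replicate i 1 ⟧ * G (suc m ℕ.+ i ∷ flat v′)
               ≡⟨ cong (_* G (suc m ℕ.+ i ∷ flat v′)) (flat-==-ones v i) ⟩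
             ⟦ i ℕ.≡ᵇ sum v ⟧ * mult (linear -1ℤ) v * G (suc m ℕ.+ i ∷ flat v′)
               ≡⟨ ℤₚ.*-assoc ⟦ i ℕ.≡ᵇ sum v ⟧ (mult (linear -1ℤ) v) _ ⟩
             ⟦ i ℕ.≡ᵇ sum v ⟧ * (mult (linear -1ℤ) v * G (suc m ℕ.+ i ∷ flat v′)) ∎)) ⟩
      eval x c * ∑ (splits w) (λ (v , v′) →
        ⟦ i ℕ.≡ᵇ sum v ⟧ * (mult (linear -1ℤ) v * G (suc m ℕ.+ i ∷ flat v′))) ∎

-- F_i contains each M_γ with γ a composition of i once, so summing over γ leaves only the condition
-- that `v` has sum i.
ev-perpF : ∀ x i c w G → IsComposition w →
  ev x (perpF i ((c , w) ∷ [])) G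
  ≡ eval x c * ∑ (splits w) (λ (v , v′) → ⟦ i ℕ.≡ᵇ sum v ⟧ * G (flat v′))
ev-perpF x i c w G cw = begin
  ev x (perpF i ((c , w) ∷ [])) G
    ≡⟨ ∑-concatMap _ _ (comps i) ⟩
  ∑ (comps i) (λ γ → ev x (perpM γ ((c , w) ∷ [])) G)
    ≡⟨ ∑-cong-All (comps-composition i) (λ γ (cγ , _) → ev-perpM x γ c w G cw cγ) ⟩
  ∑ (comps i) (λ γ → eval x c * ∑ (splits w) (λ (v , v′) → ⟦ flat v == γ ⟧ * G (flat v′)))
    ≡⟨ trans (∑-*ˡ (eval x c) _ (comps i)) (cong (eval x c *_) (∑-swap _ (comps i) (splits w))) ⟩
  eval x c * ∑ (splits w) (λ (v , v′) → ∑ (comps i) (λ γ → ⟦ flat v == γ ⟧ * G (flat v′)))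
    ≡⟨ cong (eval x c *_) (∑-cong (splits w) (λ (v , v′) → trans
         (∑-comps-pick (λ _ → G (flat v′)) i (flat v) (flat-composition v))
         (cong (λ n → ⟦ i ℕ.≡ᵇ n ⟧ * G (flat v′)) (flat-sum v)))) ⟩
  eval x c * ∑ (splits w) (λ (v , v′) → ⟦ i ℕ.≡ᵇ sum v ⟧ * G (flat v′)) ∎

ev-Bt : ∀ x m f G → Composed f → ev x (Bt (suc m) f) G ≡ ev x f (Bt* x (suc m) G)
ev-Bt x m f G cf = trans (∑-concatMap _ _ f) (∑-cong-All cf term)
  where
  term : ∀ cw → IsComposition (proj₂ cw) → _ ≡ eval x (proj₁ cw) * Bt* x (suc m) G (proj₂ cw)
  term (c , w) pw = begin
    ∑ (concatMap (λ i → scaleL (qₚ ^ₚ i) (B (suc m ℕ.+ i) (perpF i ((c , w) ∷ [])))) (upTo (suc (size w))))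
      (λ (d , u) → eval x d * G u)
      ≡⟨ ∑-concatMap _ _ (upTo (suc (size w))) ⟩
    ∑ (upTo (suc (size w))) (λ i → ev x (scaleL (qₚ ^ₚ i) (B (suc m ℕ.+ i) (perpF i ((c , w) ∷ [])))) G)
      ≡⟨ ∑-cong (upTo (suc (size w))) inner ⟩
    ∑ (upTo (suc (size w))) (λ i → eval x c * ∑ (splits w) (λ (v , v′) →
      ⟦ i ℕ.≡ᵇ sum v ⟧ * (x ℤ.^ i * B* (suc m ℕ.+ i) G (flat v′))))
      ≡⟨ trans (∑-*ˡ (eval x c) _ (upTo (suc (size w))))
           (cong (eval x c *_) (∑-swap _ (upTo (suc (size w))) (splits w))) ⟩
    eval x c * ∑ (splits w) (λ (v , v′) → ∑ (upTo (suc (size w))) (λ i →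
      ⟦ i ℕ.≡ᵇ sum v ⟧ * (x ℤ.^ i * B* (suc m ℕ.+ i) G (flat v′))))
      ≡⟨ cong (eval x c *_) (∑-cong-All (splits-sum w) (λ (v , v′) eq →
           ∑-upTo-pick (λ i → x ℤ.^ i * B* (suc m ℕ.+ i) G (flat v′)) (suc (size w)) (sum v)
             (s≤s (subst (sum v ≤_) eq (ℕₚ.m≤m+n (sum v) (sum v′)))))) ⟩
    eval x c * Bt* x (suc m) G w ∎
    where
    inner : ∀ i → ev x (scaleL (qₚ ^ₚ i) (B (suc m ℕ.+ i) (perpF i ((c , w) ∷ [])))) G
      ≡ eval x c * ∑ (splits w) (λ (v , v′) →
          ⟦ i ℕ.≡ᵇ sum v ⟧ * (x ℤ.^ i * B* (suc m ℕ.+ i) G (flat v′)))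
    inner i = begin
      ev x (scaleL (qₚ ^ₚ i) (B (suc m ℕ.+ i) (perpF i ((c , w) ∷ [])))) G
        ≡⟨ ev-scaleL x (qₚ ^ₚ i) (B (suc m ℕ.+ i) (perpF i ((c , w) ∷ []))) G ⟩
      eval x (qₚ ^ₚ i) * ev x (B (suc m ℕ.+ i) (perpF i ((c , w) ∷ []))) G
        ≡⟨ cong₂ _*_ (trans (eval-^ₚ x qₚ i) (cong (ℤ._^ i) (eval-qₚ x)))
             (trans (ev-B x (m ℕ.+ i) (perpF i ((c , w) ∷ [])) G (perpF-composed i ((c , w) ∷ [])))
               (ev-perpF x i c w (B* (suc m ℕ.+ i) G) pw)) ⟩
      x ℤ.^ i * (eval x c * ∑ (splits w) (λ (v , v′) → ⟦ i ℕ.≡ᵇ sum v ⟧ * B* (suc m ℕ.+ i) G (flat v′)))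
        ≡⟨ trans (x∙yz≈y∙xz (x ℤ.^ i) (eval x c) _)
             (cong (eval x c *_) (sym (∑-*ˡ (x ℤ.^ i) _ (splits w)))) ⟩
      eval x c * ∑ (splits w) (λ (v , v′) →
        x ℤ.^ i * (⟦ i ℕ.≡ᵇ sum v ⟧ * B* (suc m ℕ.+ i) G (flat v′)))
        ≡⟨ cong (eval x c *_) (∑-cong (splits w) (λ (v , v′) →
             x∙yz≈y∙xz (x ℤ.^ i) ⟦ i ℕ.≡ᵇ sum v ⟧ (B* (suc m ℕ.+ i) G (flat v′)))) ⟩
      eval x c * ∑ (splits w) (λ (v , v′) →
        ⟦ i ℕ.≡ᵇ sum v ⟧ * (x ℤ.^ i * B* (suc m ℕ.+ i) G (flat v′))) ∎

-- Duality of `Z` with `Q′` and with `S`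

B*-Z : ∀ x a α m w →
  B* (suc m) (Z (1ℤ + - x) (a ∷ α)) w ≡ weighted (linear (- x)) (suc m) a (Z (1ℤ + - x) α) w
B*-Z x a α m w = trans
  (∑-cong (splits w) (λ (v , v′) → cong (mult (linear -1ℤ) v *_)
    (weighted-flat (constant⁺ (1ℤ + - x)) (suc m ℕ.+ sum v) a (Z (1ℤ + - x) α) refl
      (Z-flat (1ℤ + - x) α) v′)))
  (Z-B x a α m w)

Bt*-Z : ∀ x a α m w →
  Bt* x (suc m) (Z (1ℤ + - x) (a ∷ α)) w ≡ ⟦ suc m ℕ.≡ᵇ a ⟧ * Z (1ℤ + - x) α w
Bt*-Z x a α m w = trans
  (∑-cong (splits w) (λ (v , v′) → cong (x ℤ.^ sum v *_) (trans
    (B*-Z x a α (m ℕ.+ sum v) (flat v′))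
    (weighted-flat (linear (- x)) (suc m ℕ.+ sum v) a (Z (1ℤ + - x) α) refl
      (Z-flat (1ℤ + - x) α) v′))))
  (Z-Bt x a α m w)

B*-Z-[] : ∀ y m w → B* (suc m) (Z y []) w ≡ 0ℤ
B*-Z-[] y m w = ∑-zero (splits w) (λ (v , v′) → trans
  (cong (mult (linear -1ℤ) v *_) (vanish (m ℕ.+ sum v) (mult (linear 0ℤ) (flat v′))))
  (ℤₚ.*-zeroʳ (mult (linear -1ℤ) v)))
  where
  vanish : ∀ k z → linear 0ℤ (suc k) * z ≡ 0ℤ
  vanish zero    z = refl
  vanish (suc k) z = refl

Bt*-Z-[] : ∀ x y m w → Bt* x (suc m) (Z y []) w ≡ 0ℤ
Bt*-Z-[] x y m w = ∑-zero (splits w) (λ (v , v′) → trans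
  (cong (x ℤ.^ sum v *_) (B*-Z-[] y (m ℕ.+ sum v) (flat v′)))
  (ℤₚ.*-zeroʳ (x ℤ.^ sum v)))

Q′-composed : ∀ β → IsComposition β → Composed (Q′ β)
Q′-composed []          cβ = refl ∷ []
Q′-composed (suc m ∷ β) cβ = Bt-composed m (Q′ β)

S-composed : ∀ β → IsComposition β → Composed (S β)
S-composed []          cβ = refl ∷ []
S-composed (suc m ∷ β) cβ = B-composed m (S β)

ev-one : ∀ x y α → ev x one (Z y α) ≡ ⟦ [] == α ⟧
ev-one x y []      = trans (∑-[-] _ (1ₚ , [])) (cong (_* 1ℤ) (eval-const x 1ℤ))
ev-one x y (a ∷ α) = trans (∑-[-] _ (1ₚ , [])) (ℤₚ.*-zeroʳ (eval x 1ₚ))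

ev-const-* : ∀ x f c G → ev x f (λ w → c * G w) ≡ c * ev x f G
ev-const-* x f c G = trans (∑-cong f (λ (d , w) → x∙yz≈y∙xz (eval x d) c (G w))) (∑-*ˡ c _ f)

ev-zero : ∀ x f → ev x f (λ _ → 0ℤ) ≡ 0ℤ
ev-zero x f = ∑-zero f (λ (c , w) → ℤₚ.*-zeroʳ (eval x c))

-- Moving the outermost operator across the pairing strips the first row of `α`, so the induction
-- consumes both words in parallel.
Q′-Z : ∀ x β α → IsComposition β → ev x (Q′ β) (Z (1ℤ + - x) α) ≡ ⟦ β == α ⟧
Q′-Z x []          α       cβ = ev-one x (1ℤ + - x) α
Q′-Z x (suc m ∷ β) []      cβ = begin
  ev x (Bt (suc m) (Q′ β)) (Z y [])        ≡⟨ ev-Bt x m (Q′ β) (Z y []) cQ ⟩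
  ev x (Q′ β) (Bt* x (suc m) (Z y []))     ≡⟨ ev-cong x cQ (λ w _ → Bt*-Z-[] x y m w) ⟩
  ev x (Q′ β) (λ _ → 0ℤ)                   ≡⟨ ev-zero x (Q′ β) ⟩
  0ℤ                                       ∎
  where
  y : ℤ
  y = 1ℤ + - x
  cQ : Composed (Q′ β)
  cQ = Q′-composed β cβ
Q′-Z x (suc m ∷ β) (a ∷ α) cβ = begin
  ev x (Bt (suc m) (Q′ β)) (Z y (a ∷ α))            ≡⟨ ev-Bt x m (Q′ β) (Z y (a ∷ α)) cQ ⟩
  ev x (Q′ β) (Bt* x (suc m) (Z y (a ∷ α)))         ≡⟨ ev-cong x cQ (λ w _ → Bt*-Z x a α m w) ⟩
  ev x (Q′ β) (λ w → ⟦ suc m ℕ.≡ᵇ a ⟧ * Z y α w)    ≡⟨ ev-const-* x (Q′ β) ⟦ suc m ℕ.≡ᵇ a ⟧ (Z y α) ⟩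
  ⟦ suc m ℕ.≡ᵇ a ⟧ * ev x (Q′ β) (Z y α)            ≡⟨ cong (⟦ suc m ℕ.≡ᵇ a ⟧ *_) (Q′-Z x β α cβ) ⟩
  ⟦ suc m ℕ.≡ᵇ a ⟧ * ⟦ β == α ⟧                     ≡⟨ ⟦∧⟧ (suc m ℕ.≡ᵇ a) (β == α) ⟨
  ⟦ (suc m ∷ β) == (a ∷ α) ⟧                        ∎
  where
  y : ℤ
  y = 1ℤ + - x
  cQ : Composed (Q′ β)
  cQ = Q′-composed β cβ

-- At q = 0 the series 1 - q t left by `B*-Z` is already 1, so `B*` alone strips the first row. The
-- point `x` is arbitrary: `Z 1ℤ` fixes q = 0 on the QSym side, and the signs in `B` evaluate alike
-- everywhere.
S-Z : ∀ x β α → IsComposition β → ev x (S β) (Z 1ℤ α) ≡ ⟦ β == α ⟧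
S-Z x []          α       cβ = ev-one x 1ℤ α
S-Z x (suc m ∷ β) []      cβ = begin
  ev x (B (suc m) (S β)) (Z 1ℤ [])       ≡⟨ ev-B x m (S β) (Z 1ℤ []) cS ⟩
  ev x (S β) (B* (suc m) (Z 1ℤ []))      ≡⟨ ev-cong x cS (λ w _ → B*-Z-[] 1ℤ m w) ⟩
  ev x (S β) (λ _ → 0ℤ)                  ≡⟨ ev-zero x (S β) ⟩
  0ℤ                                     ∎
  where
  cS : Composed (S β)
  cS = S-composed β cβ
S-Z x (suc m ∷ β) (a ∷ α) cβ = begin
  ev x (B (suc m) (S β)) (Z 1ℤ (a ∷ α))            ≡⟨ ev-B x m (S β) (Z 1ℤ (a ∷ α)) cS ⟩
  ev x (S β) (B* (suc m) (Z 1ℤ (a ∷ α)))           ≡⟨ ev-cong x cS (λ w _ → trans (B*-Z 0ℤ a α m w)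
                                                        (weighted-linear-0 (suc m) a (Z 1ℤ α) w)) ⟩
  ev x (S β) (λ w → ⟦ suc m ℕ.≡ᵇ a ⟧ * Z 1ℤ α w)   ≡⟨ ev-const-* x (S β) ⟦ suc m ℕ.≡ᵇ a ⟧ (Z 1ℤ α) ⟩
  ⟦ suc m ℕ.≡ᵇ a ⟧ * ev x (S β) (Z 1ℤ α)           ≡⟨ cong (⟦ suc m ℕ.≡ᵇ a ⟧ *_) (S-Z x β α cβ) ⟩
  ⟦ suc m ℕ.≡ᵇ a ⟧ * ⟦ β == α ⟧                    ≡⟨ ⟦∧⟧ (suc m ℕ.≡ᵇ a) (β == α) ⟨
  ⟦ (suc m ∷ β) == (a ∷ α) ⟧                       ∎
  where
  cS : Composed (S β)
  cS = S-composed β cβ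

-- Sums over rows and over tableaux whose first column exceeds s

∑-rowsIn-suc : ∀ N l (f : List ℕ → ℤ) →
  ∑ (rowsIn (suc l) N) f ≡ ∑ (upTo N) (λ x → ∑ (rowsIn l N) (λ r → f (suc x ∷ r)))
∑-rowsIn-suc N l f = trans (∑-concatMap _ _ (map suc (upTo N)))
  (trans (∑-map _ suc (upTo N)) (∑-cong (upTo N) (λ x → ∑-map f (suc x ∷_) (rowsIn l N))))

∑-fillings-∷ : ∀ N a α (f : Tableau → ℤ) →
  ∑ (fillings (a ∷ α) N) f ≡ ∑ (rowsIn a N) (λ r → ∑ (fillings α N) (λ T → f (r ∷ T)))
∑-fillings-∷ N a α f = trans (∑-concatMap _ _ (rowsIn a N))
  (∑-cong (rowsIn a N) (λ r → ∑-map f (r ∷_) (fillings α N)))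

-- Prefixing `suc s` to a weakly increasing row and, in `tabSum`, `s` to a strictly increasing
-- column both force entries above `s`, so one parameter serves both sums.
rowSum : ℕ → ℕ → ℕ → (List ℕ → ℤ) → ℤ
rowSum N l s Φ = ∑ (rowsIn l N) (λ r → ⟦ weaklyIncr (suc s ∷ r) ⟧ * Φ r)

tabSum : ℕ → Word → ℕ → (Tableau → ℤ) → ℤ
tabSum N α s Φ = ∑ (fillings α N) (λ T →
  ⟦ allᵇ weaklyIncr T ∧ strictlyIncr (s ∷ firstColumn T) ⟧ * Φ T)

rowSum-0 : ∀ N s Φ → rowSum N 0 s Φ ≡ Φ []
rowSum-0 N s Φ = trans (∑-[-] _ []) (ℤₚ.*-identityˡ (Φ []))

tabSum-[] : ∀ N s Φ → tabSum N [] s Φ ≡ Φ []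
tabSum-[] N s Φ = trans (∑-[-] _ []) (ℤₚ.*-identityˡ (Φ []))

rowSum-suc : ∀ N l s Φ → rowSum N (suc l) s Φ ≡
  ∑ (upTo N) (λ x → ⟦ s ℕ.<ᵇ suc x ⟧ * rowSum N l x (λ r → Φ (suc x ∷ r)))
rowSum-suc N l s Φ = trans (∑-rowsIn-suc N l _) (∑-cong (upTo N) (λ x → trans
  (∑-cong (rowsIn l N) (λ r → trans
    (cong (_* Φ (suc x ∷ r)) (⟦∧⟧ (s ℕ.<ᵇ suc x) (weaklyIncr (suc x ∷ r))))
    (ℤₚ.*-assoc ⟦ s ℕ.<ᵇ suc x ⟧ ⟦ weaklyIncr (suc x ∷ r) ⟧ (Φ (suc x ∷ r)))))
  (∑-*ˡ ⟦ s ℕ.<ᵇ suc x ⟧ _ (rowsIn l N))))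

tabSum-suc : ∀ N a α s Φ → tabSum N (suc a ∷ α) s Φ ≡ ∑ (upTo N) (λ x → ⟦ s ℕ.<ᵇ suc x ⟧ *
  rowSum N a x (λ r → tabSum N α (suc x) (λ T → Φ ((suc x ∷ r) ∷ T))))
tabSum-suc N a α s Φ = trans (∑-fillings-∷ N (suc a) α _) (trans (∑-rowsIn-suc N a _)
  (∑-cong (upTo N) (λ x → trans
    (∑-cong (rowsIn a N) (λ r → trans (∑-cong (fillings α N) (λ T → factor
        (weaklyIncr (suc x ∷ r)) (allᵇ weaklyIncr T) (s ℕ.<ᵇ suc x)
        (strictlyIncr (suc x ∷ firstColumn T)) (Φ ((suc x ∷ r) ∷ T))))
      (trans (∑-*ˡ ⟦ s ℕ.<ᵇ suc x ⟧ _ (fillings α N))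
        (cong (⟦ s ℕ.<ᵇ suc x ⟧ *_) (∑-*ˡ ⟦ weaklyIncr (suc x ∷ r) ⟧ _ (fillings α N))))))
    (∑-*ˡ ⟦ s ℕ.<ᵇ suc x ⟧ _ (rowsIn a N)))))
  where
  rearrange : ∀ p q r t z → (p * q) * (r * t) * z ≡ r * (p * ((q * t) * z))
  rearrange = solve-∀
  factor : ∀ b c d e z → ⟦ (b ∧ c) ∧ (d ∧ e) ⟧ * z ≡ ⟦ d ⟧ * (⟦ b ⟧ * (⟦ c ∧ e ⟧ * z))
  factor b c d e z = begin
    ⟦ (b ∧ c) ∧ (d ∧ e) ⟧ * z
      ≡⟨ cong (_* z) (trans (⟦∧⟧ (b ∧ c) (d ∧ e)) (cong₂ _*_ (⟦∧⟧ b c) (⟦∧⟧ d e))) ⟩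
    (⟦ b ⟧ * ⟦ c ⟧) * (⟦ d ⟧ * ⟦ e ⟧) * z
      ≡⟨ rearrange ⟦ b ⟧ ⟦ c ⟧ ⟦ d ⟧ ⟦ e ⟧ z ⟩
    ⟦ d ⟧ * (⟦ b ⟧ * ((⟦ c ⟧ * ⟦ e ⟧) * z))
      ≡⟨ cong (λ t → ⟦ d ⟧ * (⟦ b ⟧ * (t * z))) (⟦∧⟧ c e) ⟨
    ⟦ d ⟧ * (⟦ b ⟧ * (⟦ c ∧ e ⟧ * z)) ∎

∑-interval : ∀ N s (f : ℕ → ℤ) → s < N → ∑ (upTo N) (λ x → ⟦ s ℕ.<ᵇ suc x ⟧ * f x) ≡
  f s + ∑ (upTo N) (λ x → ⟦ suc s ℕ.<ᵇ suc x ⟧ * f x)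
∑-interval N s f s<N = begin
  ∑ (upTo N) (λ x → ⟦ s ℕ.<ᵇ suc x ⟧ * f x)
    ≡⟨ ∑-cong (upTo N) (λ x → trans (cong (_* f x) (<ᵇ-suc s x)) (ℤₚ.*-distribʳ-+ (f x) ⟦ x ℕ.≡ᵇ s ⟧ ⟦ s ℕ.<ᵇ x ⟧)) ⟩
  ∑ (upTo N) (λ x → ⟦ x ℕ.≡ᵇ s ⟧ * f x + ⟦ s ℕ.<ᵇ x ⟧ * f x)
    ≡⟨ ∑-+ _ _ (upTo N) ⟩
  ∑ (upTo N) (λ x → ⟦ x ℕ.≡ᵇ s ⟧ * f x) + ∑ (upTo N) (λ x → ⟦ suc s ℕ.<ᵇ suc x ⟧ * f x)
    ≡⟨ cong (_+ ∑ (upTo N) (λ x → ⟦ suc s ℕ.<ᵇ suc x ⟧ * f x)) (∑-upTo-pick f N s s<N) ⟩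
  f s + ∑ (upTo N) (λ x → ⟦ suc s ℕ.<ᵇ suc x ⟧ * f x) ∎
  where
  <ᵇ-suc : ∀ s x → ⟦ s ℕ.<ᵇ suc x ⟧ ≡ ⟦ x ℕ.≡ᵇ s ⟧ + ⟦ s ℕ.<ᵇ x ⟧
  <ᵇ-suc zero    zero    = refl
  <ᵇ-suc zero    (suc x) = refl
  <ᵇ-suc (suc s) zero    = refl
  <ᵇ-suc (suc s) (suc x) = <ᵇ-suc s x

rowSum-split : ∀ N l s Φ → s < N →
  rowSum N (suc l) s Φ ≡ rowSum N l s (λ r → Φ (suc s ∷ r)) + rowSum N (suc l) (suc s) Φ
rowSum-split N l s Φ s<N = trans (rowSum-suc N l s Φ) (trans (∑-interval N s _ s<N)
  (cong (_+_ (rowSum N l s (λ r → Φ (suc s ∷ r)))) (sym (rowSum-suc N l (suc s) Φ))))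

-- Either the corner cell holds `suc s`, and strictness of the first column puts all lower rows
-- above `suc s`, or the label `suc s` does not occur. The bound `s < N` makes this label available.
tabSum-split : ∀ N a α s Φ → s < N → tabSum N (suc a ∷ α) s Φ ≡
  rowSum N a s (λ r → tabSum N α (suc s) (λ T → Φ ((suc s ∷ r) ∷ T)))
  + tabSum N (suc a ∷ α) (suc s) Φ
tabSum-split N a α s Φ s<N = trans (tabSum-suc N a α s Φ) (trans (∑-interval N s _ s<N)
  (cong (_+_ (rowSum N a s (λ r → tabSum N α (suc s) (λ T → Φ ((suc s ∷ r) ∷ T)))))
    (sym (tabSum-suc N a α (suc s) Φ))))

∧-true : ∀ {b c} → b ∧ c ≡ true → b ≡ true × c ≡ true
∧-true {true} eq = refl , eq

≤ᵇ-true : ∀ m n → (m ℕ.≤ᵇ n) ≡ true → m ≤ n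
≤ᵇ-true m n eq = ℕₚ.≤ᵇ⇒≤ m n (subst T (sym eq) _)

weaklyIncr-All : ∀ x r → weaklyIncr (x ∷ r) ≡ true → All (x ≤_) r
weaklyIncr-All x []      eq = []
weaklyIncr-All x (y ∷ r) eq =
  let x≤y , incr = ∧-true {x ℕ.≤ᵇ y} eq
  in ≤ᵇ-true x y x≤y ∷ All.map (ℕₚ.≤-trans (≤ᵇ-true x y x≤y)) (weaklyIncr-All y r incr)

rowSum-cong : ∀ N l s {Φ Ψ} → (∀ r → All (s <_) r → Φ r ≡ Ψ r) → rowSum N l s Φ ≡ rowSum N l s Ψ
rowSum-cong N l s eq = ∑-cong (rowsIn l N) (λ r →
  ⟦⟧*-cong (weaklyIncr (suc s ∷ r)) (λ incr → eq r (weaklyIncr-All (suc s) r incr)))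

-- As `α` has no empty rows, each row is bounded below by its cell in the first column, so the
-- summand matters only on tableaux with all entries above `s`.
tabSum-cong : ∀ N α s {Φ Ψ} → IsComposition α →
  (∀ T → All (s <_) (entries T) → Φ T ≡ Ψ T) → tabSum N α s Φ ≡ tabSum N α s Ψ
tabSum-cong N []          s {Φ} {Ψ} cα eq =
  trans (tabSum-[] N s Φ) (trans (eq [] []) (sym (tabSum-[] N s Ψ)))
tabSum-cong N (suc a ∷ α) s {Φ} {Ψ} cα eq = trans (tabSum-suc N a α s Φ) (trans
  (∑-cong (upTo N) (λ x → ⟦⟧*-cong (s ℕ.<ᵇ suc x) (λ s<ᵇsx →
    let s≤x : s < suc x
        s≤x = ≤ᵇ-true (suc s) (suc x) s<ᵇsx
    in rowSum-cong N a x (λ r x<r → tabSum-cong N α (suc x) cα (λ T sx<T →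
      eq ((suc x ∷ r) ∷ T) (s≤x ∷ Allₚ.++⁺
        (All.map (ℕₚ.≤-trans s≤x) x<r)
        (All.map (ℕₚ.<-trans s≤x) sx<T)))))))
  (sym (tabSum-suc N a α s Ψ)))

rowSum-zero : ∀ N l s {Φ} → (∀ r → All (s <_) r → Φ r ≡ 0ℤ) → rowSum N l s Φ ≡ 0ℤ
rowSum-zero N l s eq = trans (rowSum-cong N l s eq)
  (∑-zero (rowsIn l N) (λ r → ℤₚ.*-zeroʳ ⟦ weaklyIncr (suc s ∷ r) ⟧))

tabSum-zero : ∀ N α s {Φ} → IsComposition α → (∀ T → All (s <_) (entries T) → Φ T ≡ 0ℤ) →
  tabSum N α s Φ ≡ 0ℤ
tabSum-zero N α s cα eq = trans (tabSum-cong N α s cα eq) (∑-zero (fillings α N)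
  (λ T → ℤₚ.*-zeroʳ ⟦ allᵇ weaklyIncr T ∧ strictlyIncr (s ∷ firstColumn T) ⟧))

∑-weighted-*ˡ : {A : Set} (xs : List A) (f g : A → ℤ) (c : ℤ) →
  ∑ xs (λ x → f x * (c * g x)) ≡ c * ∑ xs (λ x → f x * g x)
∑-weighted-*ˡ xs f g c = trans (∑-cong xs (λ x → x∙yz≈y∙xz (f x) c (g x))) (∑-*ˡ c _ xs)

∑-weighted-∑ : {A B : Set} (xs : List A) (ys : List B) (f : A → ℤ) (g : A → B → ℤ) →
  ∑ xs (λ x → f x * ∑ ys (g x)) ≡ ∑ ys (λ y → ∑ xs (λ x → f x * g x y))
∑-weighted-∑ xs ys f g = trans (∑-cong xs (λ x → sym (∑-*ˡ (f x) (g x) ys))) (∑-swap _ xs ys)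

rowSum-*ˡ : ∀ N l s c Φ → rowSum N l s (λ r → c * Φ r) ≡ c * rowSum N l s Φ
rowSum-*ˡ N l s c Φ = ∑-weighted-*ˡ (rowsIn l N) (λ r → ⟦ weaklyIncr (suc s ∷ r) ⟧) Φ c

rowSum-∑ : ∀ {A : Set} N l s (ys : List A) (Φ : List ℕ → A → ℤ) →
  rowSum N l s (λ r → ∑ ys (Φ r)) ≡ ∑ ys (λ y → rowSum N l s (λ r → Φ r y))
rowSum-∑ N l s ys Φ = ∑-weighted-∑ (rowsIn l N) ys (λ r → ⟦ weaklyIncr (suc s ∷ r) ⟧) Φ

tabSum-*ˡ : ∀ N α s c Φ → tabSum N α s (λ T → c * Φ T) ≡ c * tabSum N α s Φ
tabSum-*ˡ N α s c Φ = ∑-weighted-*ˡ (fillings α N)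
  (λ T → ⟦ allᵇ weaklyIncr T ∧ strictlyIncr (s ∷ firstColumn T) ⟧) Φ c

tabSum-∑ : ∀ {A : Set} N α s (ys : List A) (Φ : Tableau → A → ℤ) →
  tabSum N α s (λ T → ∑ ys (Φ T)) ≡ ∑ ys (λ y → tabSum N α s (λ T → Φ T y))
tabSum-∑ N α s ys Φ = ∑-weighted-∑ (fillings α N) ys
  (λ T → ⟦ allᵇ weaklyIncr T ∧ strictlyIncr (s ∷ firstColumn T) ⟧) Φ

rowSum-tabSum-factor : ∀ N l s α t (L : List (Word × Word))
  (F : Word → List ℕ → ℤ) (G : Word → Tableau → ℤ) →
  rowSum N l s (λ r → tabSum N α t (λ T → ∑ L (λ (v , w) → F v r * G w T)))
  ≡ ∑ L (λ (v , w) → rowSum N l s (F v) * tabSum N α t (G w))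
rowSum-tabSum-factor N l s α t L F G = begin
  rowSum N l s (λ r → tabSum N α t (λ T → ∑ L (λ (v , w) → F v r * G w T)))
    ≡⟨ rowSum-cong N l s (λ r _ → trans (tabSum-∑ N α t L (λ T (v , w) → F v r * G w T))
         (∑-cong L (λ (v , w) → trans (tabSum-*ˡ N α t (F v r) (G w))
           (ℤₚ.*-comm (F v r) (tabSum N α t (G w)))))) ⟩
  rowSum N l s (λ r → ∑ L (λ (v , w) → tabSum N α t (G w) * F v r))
    ≡⟨ rowSum-∑ N l s L (λ r (v , w) → tabSum N α t (G w) * F v r) ⟩
  ∑ L (λ (v , w) → rowSum N l s (λ r → tabSum N α t (G w) * F v r))
    ≡⟨ ∑-cong L (λ (v , w) → trans (rowSum-*ˡ N l s (tabSum N α t (G w)) (F v))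
         (ℤₚ.*-comm (tabSum N α t (G w)) (rowSum N l s (F v)))) ⟩
  ∑ L (λ (v , w) → rowSum N l s (F v) * tabSum N α t (G w)) ∎

-- Contents

count : ℕ → List ℕ → ℕ
count i xs = length (filterᵇ (λ x → x ℕ.≡ᵇ i) xs)

count-hit : ∀ i xs → count i (i ∷ xs) ≡ suc (count i xs)
count-hit i xs rewrite ≡ᵇ-refl i = refl

count-miss : ∀ i x xs → ¬ x ≡ i → count i (x ∷ xs) ≡ count i xs
count-miss i x xs x≢i rewrite ≡ᵇ-≢ x≢i = refl

count-none : ∀ i {xs} → All (λ x → ¬ x ≡ i) xs → count i xs ≡ 0
count-none i []                 = refl
count-none i (_∷_ {x} {xs} p ps) = trans (count-miss i x xs p) (count-none i ps)

count-++ : ∀ i xs ys → count i (xs ++ ys) ≡ count i xs ℕ.+ count i ys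
count-++ i []       ys = refl
count-++ i (x ∷ xs) ys with x ℕ.≡ᵇ i
... | true  = cong suc (count-++ i xs ys)
... | false = count-++ i xs ys

count-above : ∀ i {xs} → All (i <_) xs → count i xs ≡ 0
count-above i i<xs = count-none i (All.map (λ i<x x≡i → ℕₚ.<-irrefl (sym x≡i) i<x) i<xs)

-- Indicator that the entries of xs exceeding s have content u, with the letters of u
-- counting the labels s + 1, s + 2, …
hasContent : ℕ → List ℕ → Word → ℤ
hasContent s xs []      = ⟦ allᵇ (ℕ._≤ᵇ s) xs ⟧
hasContent s xs (b ∷ u) = ⟦ b ℕ.≡ᵇ count (suc s) xs ⟧ * hasContent (suc s) xs u

allᵇ-++ : {A : Set} (p : A → Bool) (xs ys : List A) → allᵇ p (xs ++ ys) ≡ allᵇ p xs ∧ allᵇ p ys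
allᵇ-++ p []       ys = refl
allᵇ-++ p (x ∷ xs) ys = trans (cong (p x ∧_) (allᵇ-++ p xs ys)) (sym (∧-assoc (p x) _ _))

-- Counts add under concatenation, and given the counts in `xs` and in `ys`, exactly one splitting
-- of each letter fits. The list `content T` itself ends at the largest entry and so does not add in
-- this way.
hasContent-++ : ∀ s xs ys u →
  hasContent s (xs ++ ys) u ≡ ∑ (splits u) (λ (v , w) → hasContent s xs v * hasContent s ys w)
hasContent-++ s xs ys []      = trans
  (trans (cong ⟦_⟧ (allᵇ-++ _ xs ys)) (⟦∧⟧ (allᵇ (ℕ._≤ᵇ s) xs) (allᵇ (ℕ._≤ᵇ s) ys)))
  (sym (∑-splits-[] _))
hasContent-++ s xs ys (b ∷ u) = begin
  ⟦ b ℕ.≡ᵇ count (suc s) (xs ++ ys) ⟧ * hasContent (suc s) (xs ++ ys) u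
    ≡⟨ cong₂ _*_ (trans (cong (λ n → ⟦ b ℕ.≡ᵇ n ⟧) (count-++ (suc s) xs ys))
         (sym (∑-halves-pick b cx cy))) (hasContent-++ (suc s) xs ys u) ⟩
  ∑ (halves b) (λ (i , j) → ⟦ i ℕ.≡ᵇ cx ⟧ * ⟦ j ℕ.≡ᵇ cy ⟧) * K
    ≡⟨ ∑-*ʳ K (λ (i , j) → ⟦ i ℕ.≡ᵇ cx ⟧ * ⟦ j ℕ.≡ᵇ cy ⟧) (halves b) ⟨
  ∑ (halves b) (λ (i , j) → ⟦ i ℕ.≡ᵇ cx ⟧ * ⟦ j ℕ.≡ᵇ cy ⟧ * K)
    ≡⟨ ∑-cong (halves b) (λ (i , j) → trans
         (sym (∑-*ˡ (⟦ i ℕ.≡ᵇ cx ⟧ * ⟦ j ℕ.≡ᵇ cy ⟧) _ (splits u)))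
         (∑-cong (splits u) (λ (v , w) → interchange ⟦ i ℕ.≡ᵇ cx ⟧ ⟦ j ℕ.≡ᵇ cy ⟧
           (hasContent (suc s) xs v) (hasContent (suc s) ys w)))) ⟩
  ∑ (halves b) (λ (i , j) → ∑ (splits u) (λ (v , w) →
    ⟦ i ℕ.≡ᵇ cx ⟧ * hasContent (suc s) xs v * (⟦ j ℕ.≡ᵇ cy ⟧ * hasContent (suc s) ys w)))
    ≡⟨ ∑-splits-∷ _ b u ⟨
  ∑ (splits (b ∷ u)) (λ (v , w) → hasContent s xs v * hasContent s ys w) ∎
  where
  cx cy : ℕ
  cx = count (suc s) xs
  cy = count (suc s) ys
  K : ℤ
  K = ∑ (splits u) (λ (v , w) → hasContent (suc s) xs v * hasContent (suc s) ys w)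

≤ᵇ-yes : ∀ {m n} → m ≤ n → (m ℕ.≤ᵇ n) ≡ true
≤ᵇ-yes {m} {n} m≤n with m ℕ.≤ᵇ n in eq
... | true  = refl
... | false = ⊥-elim (subst T eq (ℕₚ.≤⇒≤ᵇ m≤n))

≤ᵇ-no : ∀ {m n} → n < m → (m ℕ.≤ᵇ n) ≡ false
≤ᵇ-no {m} {n} n<m with m ℕ.≤ᵇ n in eq
... | true  = contradiction (≤ᵇ-true m n eq) (ℕₚ.<⇒≱ n<m)
... | false = refl

hasContent-low : ∀ s x xs u → x ≤ s → hasContent s (x ∷ xs) u ≡ hasContent s xs u
hasContent-low s x xs []      x≤s rewrite ≤ᵇ-yes x≤s = refl
hasContent-low s x xs (b ∷ u) x≤s = cong₂ _*_
  (cong (λ n → ⟦ b ℕ.≡ᵇ n ⟧) (count-miss (suc s) x xs (λ { refl → ℕₚ.1+n≰n x≤s })))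
  (hasContent-low (suc s) x xs u (ℕₚ.m≤n⇒m≤1+n x≤s))

hasContent-high : ∀ s x xs → s < x → hasContent s (x ∷ xs) [] ≡ 0ℤ
hasContent-high s x xs s<x rewrite ≤ᵇ-no s<x = refl

hasContent-[] : ∀ s u → hasContent s [] u ≡ mult (linear 0ℤ) u
hasContent-[] s []                = refl
hasContent-[] s (zero ∷ u)        = cong (1ℤ *_) (hasContent-[] (suc s) u)
hasContent-[] s (suc zero ∷ u)    = refl
hasContent-[] s (suc (suc b) ∷ u) = refl

-- Generating functions of rows and of tableaux by content

distinct : List ℕ → ℕ
distinct r = length (deduplicate ℕ._≟_ r)

distinct-repeat : ∀ x r → distinct (x ∷ x ∷ r) ≡ distinct (x ∷ r)
distinct-repeat x r rewrite ≡ᵇ-refl x = cong (suc ∘ length) (filter-idem _ (deduplicate ℕ._≟_ r))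

distinct-above : ∀ x r → All (x <_) r → distinct (x ∷ r) ≡ suc (distinct r)
distinct-above x r x<r = cong (suc ∘ length) (filter-all _
  (Allₚ.deduplicate⁺ ℕ._≟_ (All.map (λ x<y x≡y → ℕₚ.<-irrefl x≡y x<y) x<r)))

linear-0-graded : ∀ y v → mult (linear 0ℤ) v ≡ ⟦ sum v ℕ.≡ᵇ 0 ⟧ * mult (constant⁺ y) v
linear-0-graded y []                = refl
linear-0-graded y (zero ∷ v)        = trans (ℤₚ.*-identityˡ (mult (linear 0ℤ) v))
  (trans (linear-0-graded y v) (cong (⟦ sum v ℕ.≡ᵇ 0 ⟧ *_) (sym (ℤₚ.*-identityˡ (mult (constant⁺ y) v)))))
linear-0-graded y (suc zero ∷ v)    = refl
linear-0-graded y (suc (suc b) ∷ v) = refl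

+-suc-≤ : ∀ {s n N} → s ℕ.+ suc n ≤ N → suc s ℕ.+ n ≤ N
+-suc-≤ {s} {n} {N} = subst (_≤ N) (ℕₚ.+-suc s n)

+-≤⇒< : ∀ {s n N} → suc s ℕ.+ n ≤ N → s < N
+-≤⇒< {s} {n} = ℕₚ.≤-trans (ℕₚ.m≤m+n (suc s) n)

mutual
  -- A weakly increasing row is determined by its content, and each label that occurs contributes
  -- one factor y. The recursion runs over cells and labels together: the first cell holds `suc s`,
  -- or this label is absent.
  rowSum-content : ∀ N y l s v → s ℕ.+ length v ≤ N →
    rowSum N l s (λ r → y ℤ.^ distinct r * hasContent s r v) ≡ ⟦ sum v ℕ.≡ᵇ l ⟧ * mult (constant⁺ y) v
  rowSum-content N y zero s v le = trans (rowSum-0 N s _)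
    (trans (ℤₚ.*-identityˡ (hasContent s [] v)) (trans (hasContent-[] s v) (linear-0-graded y v)))
  rowSum-content N y (suc l) s [] le = trans (rowSum-suc N l s _)
    (trans (∑-cong (upTo N) (λ x → trans
        (⟦⟧*-cong (s ℕ.<ᵇ suc x) (λ s<ᵇsx → rowSum-zero N l x (λ r _ → trans
          (cong (y ℤ.^ distinct (suc x ∷ r) *_)
            (hasContent-high s (suc x) r (≤ᵇ-true (suc s) (suc x) s<ᵇsx)))
          (ℤₚ.*-zeroʳ (y ℤ.^ distinct (suc x ∷ r))))))
        (ℤₚ.*-zeroʳ ⟦ s ℕ.<ᵇ suc x ⟧)))
      (∑-zero (upTo N) (λ _ → refl)))
  rowSum-content N y (suc l) s (zero ∷ v) le = begin
    rowSum N (suc l) s Φ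
      ≡⟨ rowSum-split N l s Φ (+-≤⇒< (+-suc-≤ le)) ⟩
    rowSum N l s (λ r → Φ (suc s ∷ r)) + rowSum N (suc l) (suc s) Φ
      ≡⟨ cong₂ _+_ (rowSum-zero N l s (λ r _ → trans
           (cong (λ n → y ℤ.^ distinct (suc s ∷ r) * (⟦ 0 ℕ.≡ᵇ n ⟧ * hasContent (suc s) (suc s ∷ r) v))
             (count-hit (suc s) r))
           (ℤₚ.*-zeroʳ (y ℤ.^ distinct (suc s ∷ r)))))
         (rowSum-cong N (suc l) (suc s) (λ r s<r → trans
           (cong (λ n → y ℤ.^ distinct r * (⟦ 0 ℕ.≡ᵇ n ⟧ * hasContent (suc s) r v)) (count-above (suc s) s<r))
           (cong (y ℤ.^ distinct r *_) (ℤₚ.*-identityˡ (hasContent (suc s) r v))))) ⟩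
    0ℤ + rowSum N (suc l) (suc s) (λ r → y ℤ.^ distinct r * hasContent (suc s) r v)
      ≡⟨ ℤₚ.+-identityˡ _ ⟩
    rowSum N (suc l) (suc s) (λ r → y ℤ.^ distinct r * hasContent (suc s) r v)
      ≡⟨ rowSum-content N y (suc l) (suc s) v (+-suc-≤ le) ⟩
    ⟦ sum v ℕ.≡ᵇ suc l ⟧ * mult (constant⁺ y) v
      ≡⟨ cong (⟦ sum v ℕ.≡ᵇ suc l ⟧ *_) (ℤₚ.*-identityˡ (mult (constant⁺ y) v)) ⟨
    ⟦ sum v ℕ.≡ᵇ suc l ⟧ * (1ℤ * mult (constant⁺ y) v) ∎
    where
    Φ : List ℕ → ℤ
    Φ r = y ℤ.^ distinct r * hasContent s r (zero ∷ v)
  rowSum-content N y (suc l) s (suc b ∷ v) le = begin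
    rowSum N (suc l) s Φ
      ≡⟨ rowSum-split N l s Φ (+-≤⇒< (+-suc-≤ le)) ⟩
    rowSum N l s (λ r → Φ (suc s ∷ r)) + rowSum N (suc l) (suc s) Φ
      ≡⟨ cong₂ _+_ (rowSum-cong N l s (λ r _ → begin
             -- `distinct` of a non-empty list computes to a successor, which releases one factor
             -- `y`.
             y * y ℤ.^ (distinct (suc s ∷ r) ∸ 1)
               * (⟦ suc b ℕ.≡ᵇ count (suc s) (suc s ∷ r) ⟧ * hasContent (suc s) (suc s ∷ r) v)
               ≡⟨ cong₂ (λ n h → y * y ℤ.^ (distinct (suc s ∷ r) ∸ 1) * (⟦ suc b ℕ.≡ᵇ n ⟧ * h))
                    (count-hit (suc s) r) (hasContent-low (suc s) (suc s) r v ℕₚ.≤-refl) ⟩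
             y * y ℤ.^ (distinct (suc s ∷ r) ∸ 1) * (⟦ b ℕ.≡ᵇ count (suc s) r ⟧ * hasContent (suc s) r v)
               ≡⟨ ℤₚ.*-assoc y (y ℤ.^ (distinct (suc s ∷ r) ∸ 1)) _ ⟩
             y * (y ℤ.^ (distinct (suc s ∷ r) ∸ 1) * (⟦ b ℕ.≡ᵇ count (suc s) r ⟧ * hasContent (suc s) r v)) ∎))
         (rowSum-zero N (suc l) (suc s) (λ r s<r → trans
           (cong (λ n → y ℤ.^ distinct r * (⟦ suc b ℕ.≡ᵇ n ⟧ * hasContent (suc s) r v)) (count-above (suc s) s<r))
           (ℤₚ.*-zeroʳ (y ℤ.^ distinct r)))) ⟩
    rowSum N l s (λ r → y * Ψ r) + 0ℤ
      ≡⟨ ℤₚ.+-identityʳ _ ⟩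
    rowSum N l s (λ r → y * Ψ r)
      ≡⟨ rowSum-*ˡ N l s y Ψ ⟩
    y * rowSum N l s Ψ
      ≡⟨ cong (y *_) (rowSum-content-∷ N y l s b v (+-suc-≤ le)) ⟩
    y * (⟦ b ℕ.+ sum v ℕ.≡ᵇ l ⟧ * mult (constant⁺ y) v)
      ≡⟨ x∙yz≈y∙xz y ⟦ b ℕ.+ sum v ℕ.≡ᵇ l ⟧ (mult (constant⁺ y) v) ⟩
    ⟦ b ℕ.+ sum v ℕ.≡ᵇ l ⟧ * (y * mult (constant⁺ y) v) ∎
    where
    Φ Ψ : List ℕ → ℤ
    Φ r = y ℤ.^ distinct r * hasContent s r (suc b ∷ v)
    Ψ r = y ℤ.^ (distinct (suc s ∷ r) ∸ 1) * (⟦ b ℕ.≡ᵇ count (suc s) r ⟧ * hasContent (suc s) r v)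

  -- Here a copy of `suc s` already stands before the row and is discounted by the `∸ 1`. The `k`
  -- further copies are therefore free, and once they are placed the larger labels are counted by
  -- `rowSum-content`.
  rowSum-content-∷ : ∀ N y l s k v → suc s ℕ.+ length v ≤ N →
    rowSum N l s (λ r → y ℤ.^ (distinct (suc s ∷ r) ∸ 1)
      * (⟦ k ℕ.≡ᵇ count (suc s) r ⟧ * hasContent (suc s) r v))
    ≡ ⟦ k ℕ.+ sum v ℕ.≡ᵇ l ⟧ * mult (constant⁺ y) v
  rowSum-content-∷ N y zero s zero v le = trans (rowSum-0 N s _)
    (trans (ℤₚ.*-identityˡ (1ℤ * hasContent (suc s) [] v))
    (trans (ℤₚ.*-identityˡ (hasContent (suc s) [] v))
    (trans (hasContent-[] (suc s) v) (linear-0-graded y v))))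
  rowSum-content-∷ N y zero s (suc k) v le = rowSum-0 N s _
  rowSum-content-∷ N y (suc l) s zero v le = begin
    rowSum N (suc l) s Φ
      ≡⟨ rowSum-split N l s Φ (+-≤⇒< le) ⟩
    rowSum N l s (λ r → Φ (suc s ∷ r)) + rowSum N (suc l) (suc s) Φ
      ≡⟨ cong₂ _+_ (rowSum-zero N l s (λ r _ → trans
           (cong (λ n → y ℤ.^ (distinct (suc s ∷ suc s ∷ r) ∸ 1)
             * (⟦ 0 ℕ.≡ᵇ n ⟧ * hasContent (suc s) (suc s ∷ r) v)) (count-hit (suc s) r))
           (ℤₚ.*-zeroʳ (y ℤ.^ (distinct (suc s ∷ suc s ∷ r) ∸ 1)))))
         (rowSum-cong N (suc l) (suc s) (λ r s<r → trans
           (cong₂ (λ d n → y ℤ.^ (d ∸ 1) * (⟦ 0 ℕ.≡ᵇ n ⟧ * hasContent (suc s) r v))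
             (distinct-above (suc s) r s<r) (count-above (suc s) s<r))
           (cong (y ℤ.^ distinct r *_) (ℤₚ.*-identityˡ (hasContent (suc s) r v))))) ⟩
    0ℤ + rowSum N (suc l) (suc s) (λ r → y ℤ.^ distinct r * hasContent (suc s) r v)
      ≡⟨ ℤₚ.+-identityˡ _ ⟩
    rowSum N (suc l) (suc s) (λ r → y ℤ.^ distinct r * hasContent (suc s) r v)
      ≡⟨ rowSum-content N y (suc l) (suc s) v le ⟩
    ⟦ sum v ℕ.≡ᵇ suc l ⟧ * mult (constant⁺ y) v ∎
    where
    Φ : List ℕ → ℤ
    Φ r = y ℤ.^ (distinct (suc s ∷ r) ∸ 1) * (⟦ 0 ℕ.≡ᵇ count (suc s) r ⟧ * hasContent (suc s) r v)
  rowSum-content-∷ N y (suc l) s (suc k) v le = begin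
    rowSum N (suc l) s Φ
      ≡⟨ rowSum-split N l s Φ (+-≤⇒< le) ⟩
    rowSum N l s (λ r → Φ (suc s ∷ r)) + rowSum N (suc l) (suc s) Φ
      ≡⟨ cong₂ _+_ (rowSum-cong N l s (λ r _ → trans
           (cong₂ (λ d n → y ℤ.^ (d ∸ 1) * (⟦ suc k ℕ.≡ᵇ n ⟧ * hasContent (suc s) (suc s ∷ r) v))
             (distinct-repeat (suc s) r) (count-hit (suc s) r))
           (cong (λ h → y ℤ.^ (distinct (suc s ∷ r) ∸ 1) * (⟦ k ℕ.≡ᵇ count (suc s) r ⟧ * h))
             (hasContent-low (suc s) (suc s) r v ℕₚ.≤-refl))))
         (rowSum-zero N (suc l) (suc s) (λ r s<r → trans
           (cong (λ n → y ℤ.^ (distinct (suc s ∷ r) ∸ 1) * (⟦ suc k ℕ.≡ᵇ n ⟧ * hasContent (suc s) r v))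
             (count-above (suc s) s<r))
           (ℤₚ.*-zeroʳ (y ℤ.^ (distinct (suc s ∷ r) ∸ 1))))) ⟩
    rowSum N l s Ψ + 0ℤ
      ≡⟨ ℤₚ.+-identityʳ _ ⟩
    rowSum N l s Ψ
      ≡⟨ rowSum-content-∷ N y l s k v le ⟩
    ⟦ k ℕ.+ sum v ℕ.≡ᵇ l ⟧ * mult (constant⁺ y) v ∎
    where
    Φ Ψ : List ℕ → ℤ
    Φ r = y ℤ.^ (distinct (suc s ∷ r) ∸ 1) * (⟦ suc k ℕ.≡ᵇ count (suc s) r ⟧ * hasContent (suc s) r v)
    Ψ r = y ℤ.^ (distinct (suc s ∷ r) ∸ 1) * (⟦ k ℕ.≡ᵇ count (suc s) r ⟧ * hasContent (suc s) r v)

-- If the label `suc s` occurs, it fills the corner, and since the lower rows lie above it, all its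
-- copies are in the first row. The rest of the content is shared between the rest of that row and
-- the lower rows, one splitting for each way of sharing; this is the recursion of `Z`.
tabSum-content : ∀ N y α s u → IsComposition α → s ℕ.+ length u ≤ N →
  tabSum N α s (λ T → y ℤ.^ nStat T * hasContent s (entries T) u) ≡ Z y α u
tabSum-content N y [] s u cα le = trans (tabSum-[] N s _)
  (trans (ℤₚ.*-identityˡ (hasContent s [] u)) (hasContent-[] s u))
tabSum-content N y (suc a ∷ α) s [] cα le = trans (tabSum-suc N a α s _)
  (trans (∑-cong (upTo N) (λ x → trans
      (⟦⟧*-cong (s ℕ.<ᵇ suc x) (λ s<ᵇsx → rowSum-zero N a x (λ r _ → tabSum-zero N α (suc x) cα (λ T _ → trans
        (cong (y ℤ.^ nStat ((suc x ∷ r) ∷ T) *_)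
          (hasContent-high s (suc x) (r ++ entries T) (≤ᵇ-true (suc s) (suc x) s<ᵇsx)))
        (ℤₚ.*-zeroʳ (y ℤ.^ nStat ((suc x ∷ r) ∷ T)))))))
      (ℤₚ.*-zeroʳ ⟦ s ℕ.<ᵇ suc x ⟧)))
    (∑-zero (upTo N) (λ _ → refl)))
tabSum-content N y (suc a ∷ α) s (zero ∷ u) cα le = begin
  tabSum N (suc a ∷ α) s Φ
    ≡⟨ tabSum-split N a α s Φ (+-≤⇒< (+-suc-≤ le)) ⟩
  rowSum N a s (λ r → tabSum N α (suc s) (λ T → Φ ((suc s ∷ r) ∷ T))) + tabSum N (suc a ∷ α) (suc s) Φ
    ≡⟨ cong₂ _+_
         (rowSum-zero N a s (λ r _ → tabSum-zero N α (suc s) cα (λ T _ → trans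
           (cong (λ n → y ℤ.^ nStat ((suc s ∷ r) ∷ T)
             * (⟦ 0 ℕ.≡ᵇ n ⟧ * hasContent (suc s) (suc s ∷ r ++ entries T) u))
             (count-hit (suc s) (r ++ entries T)))
           (ℤₚ.*-zeroʳ (y ℤ.^ nStat ((suc s ∷ r) ∷ T))))))
         (tabSum-cong N (suc a ∷ α) (suc s) cα (λ T s<T → trans
           (cong (λ n → y ℤ.^ nStat T * (⟦ 0 ℕ.≡ᵇ n ⟧ * hasContent (suc s) (entries T) u))
             (count-above (suc s) s<T))
           (cong (y ℤ.^ nStat T *_) (ℤₚ.*-identityˡ (hasContent (suc s) (entries T) u))))) ⟩
  0ℤ + tabSum N (suc a ∷ α) (suc s) (λ T → y ℤ.^ nStat T * hasContent (suc s) (entries T) u)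
    ≡⟨ ℤₚ.+-identityˡ _ ⟩
  tabSum N (suc a ∷ α) (suc s) (λ T → y ℤ.^ nStat T * hasContent (suc s) (entries T) u)
    ≡⟨ tabSum-content N y (suc a ∷ α) (suc s) u cα (+-suc-≤ le) ⟩
  Z y (suc a ∷ α) u ∎
  where
  Φ : Tableau → ℤ
  Φ T = y ℤ.^ nStat T * hasContent s (entries T) (zero ∷ u)
tabSum-content N y (suc a ∷ α) s (suc k ∷ u) cα le = begin
  tabSum N (suc a ∷ α) s Φ
    ≡⟨ tabSum-split N a α s Φ (+-≤⇒< (+-suc-≤ le)) ⟩
  rowSum N a s (λ r → tabSum N α (suc s) (λ T → Φ ((suc s ∷ r) ∷ T))) + tabSum N (suc a ∷ α) (suc s) Φ
    ≡⟨ cong₂ _+_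
         (rowSum-cong N a s (λ r _ → tabSum-cong N α (suc s) cα (λ T s<T → expand r T s<T)))
         (tabSum-zero N (suc a ∷ α) (suc s) cα (λ T s<T → trans
           (cong (λ n → y ℤ.^ nStat T * (⟦ suc k ℕ.≡ᵇ n ⟧ * hasContent (suc s) (entries T) u))
             (count-above (suc s) s<T))
           (ℤₚ.*-zeroʳ (y ℤ.^ nStat T)))) ⟩
  rowSum N a s (λ r → tabSum N α (suc s) (λ T → ∑ (splits u) (λ (v , w) → F v r * G w T))) + 0ℤ
    ≡⟨ trans (ℤₚ.+-identityʳ _) (rowSum-tabSum-factor N a s α (suc s) (splits u) F G) ⟩
  ∑ (splits u) (λ (v , w) → rowSum N a s (F v) * tabSum N α (suc s) (G w))
    -- Both halves keep the length of `u`, zeros included, so a letter's position still names its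
    -- label and the bound by `N` persists.
    ≡⟨ ∑-cong-All (splits-length u) (λ (v , w) (lv , lw) → trans
         (cong₂ _*_
           (rowSum-content-∷ N y a s k v (subst (λ n → suc s ℕ.+ n ≤ N) (sym lv) (+-suc-≤ le)))
           (tabSum-content N y α (suc s) w cα (subst (λ n → suc s ℕ.+ n ≤ N) (sym lw) (+-suc-≤ le))))
         (ℤₚ.*-assoc ⟦ k ℕ.+ sum v ℕ.≡ᵇ a ⟧ (mult (constant⁺ y) v) (Z y α w))) ⟩
  Z y (suc a ∷ α) (suc k ∷ u) ∎
  where
  Φ : Tableau → ℤ
  Φ T = y ℤ.^ nStat T * hasContent s (entries T) (suc k ∷ u)
  F : Word → List ℕ → ℤ
  F v r = y ℤ.^ (distinct (suc s ∷ r) ∸ 1) * (⟦ k ℕ.≡ᵇ count (suc s) r ⟧ * hasContent (suc s) r v)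
  G : Word → Tableau → ℤ
  G w T = y ℤ.^ nStat T * hasContent (suc s) (entries T) w
  rearrange : ∀ p q t c d → (p * (t * c)) * (q * d) ≡ (p * q * t) * (c * d)
  rearrange = solve-∀
  expand : ∀ r T → All (suc s <_) (entries T) →
    Φ ((suc s ∷ r) ∷ T) ≡ ∑ (splits u) (λ (v , w) → F v r * G w T)
  expand r T s<T = begin
    y ℤ.^ (d ℕ.+ nStat T) * (⟦ suc k ℕ.≡ᵇ count (suc s) (suc s ∷ r ++ entries T) ⟧
      * hasContent (suc s) (suc s ∷ r ++ entries T) u)
      ≡⟨ cong₂ _*_ (ℤₚ.^-distribˡ-+-* y d (nStat T)) (cong₂ (λ n h → ⟦ suc k ℕ.≡ᵇ n ⟧ * h)
           count-eq
           (trans (hasContent-low (suc s) (suc s) (r ++ entries T) u ℕₚ.≤-refl)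
             (hasContent-++ (suc s) r (entries T) u))) ⟩
    y ℤ.^ d * y ℤ.^ nStat T * (⟦ k ℕ.≡ᵇ count (suc s) r ⟧
      * ∑ (splits u) (λ (v , w) → hasContent (suc s) r v * hasContent (suc s) (entries T) w))
      ≡⟨ ℤₚ.*-assoc (y ℤ.^ d * y ℤ.^ nStat T) ⟦ k ℕ.≡ᵇ count (suc s) r ⟧ _ ⟨
    y ℤ.^ d * y ℤ.^ nStat T * ⟦ k ℕ.≡ᵇ count (suc s) r ⟧
      * ∑ (splits u) (λ (v , w) → hasContent (suc s) r v * hasContent (suc s) (entries T) w)
      ≡⟨ ∑-*ˡ (y ℤ.^ d * y ℤ.^ nStat T * ⟦ k ℕ.≡ᵇ count (suc s) r ⟧) _ (splits u) ⟨
    ∑ (splits u) (λ (v , w) → y ℤ.^ d * y ℤ.^ nStat T * ⟦ k ℕ.≡ᵇ count (suc s) r ⟧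
      * (hasContent (suc s) r v * hasContent (suc s) (entries T) w))
      ≡⟨ ∑-cong (splits u) (λ (v , w) → rearrange (y ℤ.^ d) (y ℤ.^ nStat T)
           ⟦ k ℕ.≡ᵇ count (suc s) r ⟧ (hasContent (suc s) r v) (hasContent (suc s) (entries T) w)) ⟨
    ∑ (splits u) (λ (v , w) → F v r * G w T) ∎
    where
    d : ℕ
    d = distinct (suc s ∷ r) ∸ 1
    count-eq : count (suc s) (suc s ∷ r ++ entries T) ≡ suc (count (suc s) r)
    count-eq = trans (count-hit (suc s) (r ++ entries T)) (cong suc (trans
      (count-++ (suc s) r (entries T))
      (trans (cong (count (suc s) r ℕ.+_) (count-above (suc s) s<T)) (ℕₚ.+-identityʳ _))))

-- The coefficients of Rhs

max : List ℕ → ℕ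
max = foldr ℕ._⊔_ 0

≤-max : ∀ xs → All (_≤ max xs) xs
≤-max []       = []
≤-max (x ∷ xs) = ℕₚ.m≤m⊔n x (max xs) ∷ All.map (λ le → ℕₚ.≤-trans le (ℕₚ.m≤n⊔m x (max xs))) (≤-max xs)

allᵇ-All : ∀ {A : Set} {p : A → Bool} {xs} → All (λ x → p x ≡ true) xs → allᵇ p xs ≡ true
allᵇ-All []       = refl
allᵇ-All (e ∷ es) = cong₂ _∧_ e (allᵇ-All es)

max-≤ : ∀ s xs → allᵇ (ℕ._≤ᵇ s) xs ≡ true → max xs ≤ s
max-≤ s []       _  = z≤n
max-≤ s (x ∷ xs) eq =
  let x≤s , xs≤s = ∧-true {x ℕ.≤ᵇ s} eq
  in ℕₚ.⊔-lub (≤ᵇ-true x s x≤s) (max-≤ s xs xs≤s)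

count-below : ∀ s {xs} → All (_≤ s) xs → count (suc s) xs ≡ 0
count-below s xs≤s = count-none (suc s) (All.map (λ { x≤s refl → ℕₚ.1+n≰n x≤s }) xs≤s)

≡ᵇ-sym : ∀ m n → (m ℕ.≡ᵇ n) ≡ (n ℕ.≡ᵇ m)
≡ᵇ-sym zero    zero    = refl
≡ᵇ-sym zero    (suc n) = refl
≡ᵇ-sym (suc m) zero    = refl
≡ᵇ-sym (suc m) (suc n) = ≡ᵇ-sym m n

-- The content on the labels s + 1, ..., s + d, with the starting point made explicit so that an
-- induction can move it.
counts : ℕ → ℕ → List ℕ → Word
counts s zero    xs = []
counts s (suc d) xs = count (suc s) xs ∷ counts (suc s) d xs

counts-applyUpTo : ∀ s d xs (f : ℕ → ℕ) → (∀ i → f i ≡ count (suc (s ℕ.+ i)) xs) →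
  applyUpTo f d ≡ counts s d xs
counts-applyUpTo s zero    xs f eq = refl
counts-applyUpTo s (suc d) xs f eq = cong₂ _∷_
  (trans (eq 0) (cong (λ n → count (suc n) xs) (ℕₚ.+-identityʳ s)))
  (counts-applyUpTo (suc s) d xs (f ∘ suc)
    (λ i → trans (eq (suc i)) (cong (λ n → count (suc n) xs) (ℕₚ.+-suc s i))))

content-counts : ∀ T → content T ≡ counts 0 (maxEntry T) (entries T)
content-counts T = trans (map-upTo _ (maxEntry T))
  (counts-applyUpTo 0 (maxEntry T) (entries T) _ (λ _ → refl))

-- The left word ends at the largest entry, while the right side ends with `u`. Since the letters of
-- `u` are positive, one beyond the largest entry meets the count 0; and if `u` ends too early, some
-- entry still exceeds `s`.
counts-hasContent : ∀ s d xs u → max xs ∸ s ≡ d → IsComposition u →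
  ⟦ counts s d xs == u ⟧ ≡ hasContent s xs u
counts-hasContent s zero    xs []          eq cu = cong ⟦_⟧ (sym (allᵇ-All (All.map
  (λ x≤m → ≤ᵇ-yes (ℕₚ.≤-trans x≤m (ℕₚ.m∸n≡0⇒m≤n eq))) (≤-max xs))))
counts-hasContent s (suc d) xs []          eq cu with allᵇ (ℕ._≤ᵇ s) xs in all≤
... | true  = contradiction (trans (sym eq) (ℕₚ.m≤n⇒m∸n≡0 (max-≤ s xs all≤))) λ ()
... | false = refl
counts-hasContent s zero    xs (suc b ∷ u) eq cu = sym (cong (λ n → ⟦ suc b ℕ.≡ᵇ n ⟧ * hasContent (suc s) xs u)
  (count-below s (All.map (λ x≤m → ℕₚ.≤-trans x≤m (ℕₚ.m∸n≡0⇒m≤n eq)) (≤-max xs))))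
counts-hasContent s (suc d) xs (suc b ∷ u) eq cu = begin
  ⟦ (count (suc s) xs ℕ.≡ᵇ suc b) ∧ (counts (suc s) d xs == u) ⟧
    ≡⟨ ⟦∧⟧ (count (suc s) xs ℕ.≡ᵇ suc b) (counts (suc s) d xs == u) ⟩
  ⟦ count (suc s) xs ℕ.≡ᵇ suc b ⟧ * ⟦ counts (suc s) d xs == u ⟧
    ≡⟨ cong₂ _*_ (cong ⟦_⟧ (≡ᵇ-sym (count (suc s) xs) (suc b)))
         (counts-hasContent (suc s) d xs u
           (trans (sym (ℕₚ.pred[m∸n]≡m∸[1+n] (max xs) s)) (cong ℕ.pred eq)) cu) ⟩
  ⟦ suc b ℕ.≡ᵇ count (suc s) xs ⟧ * hasContent (suc s) xs u ∎

content-hasContent : ∀ T u → IsComposition u → ⟦ content T == u ⟧ ≡ hasContent 0 (entries T) u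
content-hasContent T u cu = trans (cong (λ v → ⟦ v == u ⟧) (content-counts T))
  (counts-hasContent 0 (maxEntry T) (entries T) u refl cu)

-- Positive letters in excess of the available labels demand an occurrence of the label N + 1.
hasContent-long : ∀ N s xs u → All (_≤ N) xs → s ≤ N → N < s ℕ.+ length u → IsComposition u →
  hasContent s xs u ≡ 0ℤ
hasContent-long N s xs []          xs≤N s≤N N<s cu =
  contradiction s≤N (ℕₚ.<⇒≱ (subst (N <_) (ℕₚ.+-identityʳ s) N<s))
hasContent-long N s xs (suc b ∷ u) xs≤N s≤N N<s cu with s ℕ.≟ N
... | yes refl = cong (λ n → ⟦ suc b ℕ.≡ᵇ n ⟧ * hasContent (suc s) xs u) (count-below s xs≤N)
... | no  s≢N  = trans (cong (⟦ suc b ℕ.≡ᵇ count (suc s) xs ⟧ *_)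
    (hasContent-long N (suc s) xs u xs≤N (ℕₚ.≤∧≢⇒< s≤N s≢N)
      (subst (N <_) (ℕₚ.+-suc s (length u)) N<s) cu))
  (ℤₚ.*-zeroʳ ⟦ suc b ℕ.≡ᵇ count (suc s) xs ⟧)

rowsIn-≤ : ∀ l N → All (All (_≤ N)) (rowsIn l N)
rowsIn-≤ zero    N = [] ∷ []
rowsIn-≤ (suc l) N = All-concatMap (Allₚ.map⁺ (Allₚ.all-upTo N))
  (λ x x≤N → Allₚ.map⁺ (All.map (x≤N ∷_) (rowsIn-≤ l N)))

fillings-≤ : ∀ α N → All (λ T → All (_≤ N) (entries T)) (fillings α N)
fillings-≤ []      N = [] ∷ []
fillings-≤ (a ∷ α) N = All-concatMap (rowsIn-≤ a N)
  (λ r r≤N → Allₚ.map⁺ (All.map (Allₚ.++⁺ r≤N) (fillings-≤ α N)))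

-- Entries are positive, so a strict first column is one exceeding 0.
tabSum-unbounded : ∀ N α Φ → IsComposition α →
  ∑ (fillings α N) (λ T → ⟦ allᵇ weaklyIncr T ∧ strictlyIncr (firstColumn T) ⟧ * Φ T) ≡ tabSum N α 0 Φ
tabSum-unbounded N []          Φ cα = trans (∑-[-] _ []) (sym (∑-[-] _ []))
tabSum-unbounded N (suc a ∷ α) Φ cα = trans (expand _) (sym (expand _))
  where
  expand : ∀ f → ∑ (fillings (suc a ∷ α) N) f ≡
    ∑ (upTo N) (λ x → ∑ (rowsIn a N) (λ r → ∑ (fillings α N) (λ T → f ((suc x ∷ r) ∷ T))))
  expand f = trans (∑-fillings-∷ N (suc a) α f) (∑-rowsIn-suc N a _)

length-≤-sum : ∀ u → IsComposition u → length u ≤ sum u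
length-≤-sum []          cu = z≤n
length-≤-sum (suc k ∷ u) cu = s≤s (ℕₚ.≤-trans (length-≤-sum u cu) (ℕₚ.m≤n+m (sum u) k))

immaculate-sum : ∀ y α u → IsComposition α → IsComposition u →
  ∑ (immTableaux α) (λ T → ⟦ content T == u ⟧ * y ℤ.^ nStat T) ≡ Z y α u
immaculate-sum y α u cα cu = begin
  ∑ (immTableaux α) (λ T → ⟦ content T == u ⟧ * y ℤ.^ nStat T)
    ≡⟨ ∑-filterᵇ _ isImmaculate (fillings α N) ⟩
  ∑ (fillings α N) (λ T → ⟦ isImmaculate T ⟧ * (⟦ content T == u ⟧ * y ℤ.^ nStat T))
    ≡⟨ ∑-cong (fillings α N) (λ T → trans
         (drop (allᵇ weaklyIncr T) (strictlyIncr (firstColumn T)) (content T) (y ℤ.^ nStat T))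
         (cong (λ h → ⟦ allᵇ weaklyIncr T ∧ strictlyIncr (firstColumn T) ⟧ * (y ℤ.^ nStat T * h))
           (content-hasContent T u cu))) ⟩
  ∑ (fillings α N) (λ T → ⟦ allᵇ weaklyIncr T ∧ strictlyIncr (firstColumn T) ⟧ * Φ T)
    ≡⟨ tabSum-unbounded N α Φ cα ⟩
  tabSum N α 0 Φ
    ≡⟨ sizes (ℕₚ.≤-<-connex (length u) N) ⟩
  Z y α u ∎
  where
  N : ℕ
  N = size α
  Φ : Tableau → ℤ
  Φ T = y ℤ.^ nStat T * hasContent 0 (entries T) u
  -- Where the content is `u`, the composition test inside `isImmaculate` follows from `cu`;
  -- elsewhere both sides vanish.
  drop : ∀ b c v z →
    ⟦ b ∧ c ∧ isComposition v ⟧ * (⟦ v == u ⟧ * z) ≡ ⟦ b ∧ c ⟧ * (z * ⟦ v == u ⟧)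
  drop b c v z with v == u in eq
  ... | false = trans (ℤₚ.*-zeroʳ ⟦ b ∧ c ∧ isComposition v ⟧)
    (sym (trans (cong (⟦ b ∧ c ⟧ *_) (ℤₚ.*-zeroʳ z)) (ℤₚ.*-zeroʳ ⟦ b ∧ c ⟧)))
  ... | true  = cong₂ _*_
    (cong ⟦_⟧ (trans (cong (λ e → b ∧ c ∧ e) (trans (cong isComposition (==-sound v u eq)) cu))
      (cong (b ∧_) (∧-comm c true))))
    (ℤₚ.*-comm 1ℤ z)
  -- A composition longer than `N` has size greater than `N`, and then both sides are 0: no tableau
  -- has enough labels, and `Z` is homogeneous.
  sizes : length u ≤ N ⊎ N < length u → tabSum N α 0 Φ ≡ Z y α u
  sizes (inj₁ le) = tabSum-content N y α 0 u cα le
  sizes (inj₂ lt) = trans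
    (trans (∑-cong-All (fillings-≤ α N) (λ T T≤N → trans
        (cong (λ h → ⟦ allᵇ weaklyIncr T ∧ strictlyIncr (0 ∷ firstColumn T) ⟧ * (y ℤ.^ nStat T * h))
          (hasContent-long N 0 (entries T) u T≤N z≤n lt cu))
        (trans (cong (⟦ allᵇ weaklyIncr T ∧ strictlyIncr (0 ∷ firstColumn T) ⟧ *_) (ℤₚ.*-zeroʳ (y ℤ.^ nStat T)))
          (ℤₚ.*-zeroʳ ⟦ allᵇ weaklyIncr T ∧ strictlyIncr (0 ∷ firstColumn T) ⟧))))
      (∑-zero (fillings α N) (λ _ → refl)))
    (sym (Z-graded y α u (λ eq → ℕₚ.<-irrefl refl (ℕₚ.<-≤-trans lt
      (subst (length u ≤_) eq (length-≤-sum u cu))))))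

eval-coeffOf : ∀ x f w → eval x (coeffOf f w) ≡ ∑ f (λ (c , u) → ⟦ u == w ⟧ * eval x c)
eval-coeffOf x []            w = sym (∑-[] _)
eval-coeffOf x ((c , u) ∷ f) w = trans (eval-⊕ x (if u == w then c else 0ₚ) (coeffOf f w))
  (trans (cong₂ _+_ (eval-if (u == w)) (eval-coeffOf x f w)) (sym (∑-∷ _ (c , u) f)))
  where
  eval-if : ∀ b → eval x (if b then c else 0ₚ) ≡ ⟦ b ⟧ * eval x c
  eval-if true  = sym (ℤₚ.*-identityˡ (eval x c))
  eval-if false = refl

eval-pair : ∀ x f g → eval x (pair f g) ≡ ev x f (λ w → eval x (coeffOf g w))
eval-pair x []            g = sym (∑-[] _)
eval-pair x ((c , w) ∷ f) g = trans (eval-⊕ x (c ⊗ coeffOf g w) (pair f g))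
  (trans (cong₂ _+_ (eval-⊗ x c (coeffOf g w)) (eval-pair x f g)) (sym (∑-∷ _ (c , w) f)))

eval-spec : ∀ x z f w → eval x (coeffOf (spec z f) w) ≡ eval z (coeffOf f w)
eval-spec x z f w = trans (eval-coeffOf x (spec z f) w) (trans (∑-map _ _ f)
  (trans (∑-cong f (λ (c , u) → cong (⟦ u == w ⟧ *_) (eval-const x (eval z c))))
    (sym (eval-coeffOf z f w))))

eval-δ : ∀ x u v → eval x (δ u v) ≡ ⟦ u == v ⟧
eval-δ x u v with u == v
... | true  = eval-const x 1ℤ
... | false = refl

eval-Rhs : ∀ x α w → eval x (coeffOf (Rhs α) w) ≡
  ∑ (immTableaux α) (λ T → ⟦ content T == w ⟧ * (1ℤ + - x) ℤ.^ nStat T)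
eval-Rhs x α w = trans (eval-coeffOf x (Rhs α) w) (trans (∑-map _ _ (immTableaux α))
  (∑-cong (immTableaux α) (λ T → cong (⟦ content T == w ⟧ *_)
    (trans (eval-^ₚ x (1ₚ ⊕ negₚ qₚ) (nStat T)) (cong (ℤ._^ nStat T) eval-1-q)))))
  where
  eval-1-q : eval x (1ₚ ⊕ negₚ qₚ) ≡ 1ℤ + - x
  eval-1-q = trans (eval-⊕ x 1ₚ (negₚ qₚ))
    (cong₂ _+_ (eval-const x 1ℤ) (trans (eval-neg x qₚ) (cong -_ (eval-qₚ x))))

Rhs-Z : ∀ x α w → IsComposition α → IsComposition w → eval x (coeffOf (Rhs α) w) ≡ Z (1ℤ + - x) α w
Rhs-Z x α w cα cw = trans (eval-Rhs x α w) (immaculate-sum (1ℤ + - x) α w cα cw)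

-- Polynomials agreeing at all positive integers

coeff-⊕ : ∀ p r k → coeff (p ⊕ r) k ≡ coeff p k + coeff r k
coeff-⊕ []      r       k       = sym (ℤₚ.+-identityˡ (coeff r k))
coeff-⊕ (a ∷ p) []      zero    = sym (ℤₚ.+-identityʳ a)
coeff-⊕ (a ∷ p) []      (suc k) = sym (ℤₚ.+-identityʳ (coeff p k))
coeff-⊕ (a ∷ p) (b ∷ r) zero    = refl
coeff-⊕ (a ∷ p) (b ∷ r) (suc k) = coeff-⊕ p r k

coeff-neg : ∀ p k → coeff (negₚ p) k ≡ - coeff p k
coeff-neg []      k       = refl
coeff-neg (a ∷ p) zero    = refl
coeff-neg (a ∷ p) (suc k) = coeff-neg p k

-- The constant term a is divisible by every x > 0, in particular by |a| + 1.
coeff-zero : ∀ p → (∀ n → eval (+ suc n) p ≡ 0ℤ) → ∀ k → coeff p k ≡ 0ℤ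
coeff-zero []      vanish k = refl
coeff-zero (a ∷ p) vanish = λ where
    zero    → a≡0
    (suc k) → coeff-zero p vanish′ k
  where
  ∣a∣≡ : ∀ n → ∣ a ∣ ≡ suc n ℕ.* ∣ eval (+ suc n) p ∣
  ∣a∣≡ n = begin
    ∣ a ∣                                ≡⟨ cong ∣_∣ (isolate a (+ suc n * eval (+ suc n) p)) ⟩
    ∣ a + xe + - xe ∣                    ≡⟨ cong (λ s → ∣ s + - xe ∣) (vanish n) ⟩
    ∣ 0ℤ + - xe ∣                        ≡⟨ cong ∣_∣ (ℤₚ.+-identityˡ (- xe)) ⟩
    ∣ - xe ∣                             ≡⟨ ℤₚ.∣-i∣≡∣i∣ xe ⟩
    ∣ xe ∣                               ≡⟨ ℤₚ.abs-* (+ suc n) (eval (+ suc n) p) ⟩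
    suc n ℕ.* ∣ eval (+ suc n) p ∣       ∎
    where
    xe : ℤ
    xe = + suc n * eval (+ suc n) p
    isolate : ∀ s t → s ≡ s + t + - t
    isolate = solve-∀
  m≡[1+m]n⇒m≡0 : ∀ m n → m ≡ suc m ℕ.* n → m ≡ 0
  m≡[1+m]n⇒m≡0 m zero    eq = trans eq (ℕₚ.*-zeroʳ m)
  m≡[1+m]n⇒m≡0 m (suc n) eq = contradiction
    (subst (suc m ≤_) (sym eq) (ℕₚ.m≤m*n (suc m) (suc n))) ℕₚ.1+n≰n
  a≡0 : a ≡ 0ℤ
  a≡0 = ℤₚ.∣i∣≡0⇒i≡0 (m≡[1+m]n⇒m≡0 ∣ a ∣ _ (∣a∣≡ ∣ a ∣))
  vanish′ : ∀ n → eval (+ suc n) p ≡ 0ℤ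
  vanish′ n = ℤₚ.∣i∣≡0⇒i≡0 (ℕₚ.m+n≡0⇒m≡0 _ (trans (sym (∣a∣≡ n)) (cong ∣_∣ a≡0)))

eval-injective : ∀ p r → (∀ x → eval x p ≡ eval x r) → p ≈ₚ r
eval-injective p r eq k = begin
  coeff p k                                ≡⟨ isolate (coeff p k) (coeff r k) ⟩
  coeff p k + - coeff r k + coeff r k      ≡⟨ cong (_+ coeff r k) difference ⟩
  0ℤ + coeff r k                           ≡⟨ ℤₚ.+-identityˡ (coeff r k) ⟩
  coeff r k                                ∎
  where
  isolate : ∀ s t → s ≡ s + - t + t
  isolate = solve-∀
  difference : coeff p k + - coeff r k ≡ 0ℤ
  difference = trans (sym (trans (coeff-⊕ p (negₚ r) k) (cong (_+_ (coeff p k)) (coeff-neg r k))))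
    (coeff-zero (p ⊕ negₚ r) (λ n → trans (eval-⊕ (+ suc n) p (negₚ r))
      (trans (cong₂ _+_ (eq (+ suc n)) (eval-neg (+ suc n) r)) (ℤₚ.+-inverseʳ (eval (+ suc n) r)))) k)

-- The value at q = 1 and the final assembly

-- No immaculate tableau has a zero in its content. The claim at q = 1 concerns all words, including
-- those with a zero letter, which the comparison with `Z` does not cover.
Rhs-noncomposition : ∀ x α w → isComposition w ≡ false → eval x (coeffOf (Rhs α) w) ≡ 0ℤ
Rhs-noncomposition x α w nw = trans (eval-Rhs x α w)
  (trans (∑-filterᵇ _ isImmaculate (fillings α (size α)))
    (∑-zero (fillings α (size α)) (λ T →
      vanish (allᵇ weaklyIncr T) (strictlyIncr (firstColumn T)) (content T) ((1ℤ + - x) ℤ.^ nStat T))))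
  where
  vanish : ∀ b c v z → ⟦ b ∧ c ∧ isComposition v ⟧ * (⟦ v == w ⟧ * z) ≡ 0ℤ
  vanish b c v z with v == w in eq
  ... | false = ℤₚ.*-zeroʳ ⟦ b ∧ c ∧ isComposition v ⟧
  ... | true  = cong (λ e → ⟦ e ⟧ * (1ℤ * z)) (begin
    b ∧ c ∧ isComposition v  ≡⟨ cong (λ u → b ∧ c ∧ isComposition u) (==-sound v w eq) ⟩
    b ∧ c ∧ isComposition w  ≡⟨ cong (λ e → b ∧ c ∧ e) nw ⟩
    b ∧ c ∧ false            ≡⟨ cong (b ∧_) (∧-comm c false) ⟩
    b ∧ false                ≡⟨ ∧-comm b false ⟩
    false                    ∎)

Rhs-at-1 : ∀ α w → IsComposition α → eval 1ℤ (coeffOf (Rhs α) w) ≡ ⟦ w == α ⟧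
Rhs-at-1 α w cα with isComposition w in cw
... | true  = trans (Rhs-Z 1ℤ α w cα cw) (Z-0 α w cw)
... | false with w == α in eq
...   | false = Rhs-noncomposition 1ℤ α w cw
...   | true  = contradiction (trans (sym cα) (trans (cong isComposition (sym (==-sound w α eq))) cw)) λ ()

theorem4p15 : (α : Word) → IsComposition α →
    ((β : Word) → IsComposition β → pair (Q′ β) (Rhs α) ≈ₚ δ β α)
    × ((β : Word) → coeffOf (spec (+ 1) (Rhs α)) β ≈ₚ δ β α)
    × ((β : Word) → IsComposition β → pair (S β) (spec (+ 0) (Rhs α)) ≈ₚ δ β α)
theorem4p15 α cα =
  (λ β cβ → eval-injective (pair (Q′ β) (Rhs α)) (δ β α) (λ x → begin
    eval x (pair (Q′ β) (Rhs α))
      ≡⟨ eval-pair x (Q′ β) (Rhs α) ⟩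
    ev x (Q′ β) (λ w → eval x (coeffOf (Rhs α) w))
      ≡⟨ ev-cong x (Q′-composed β cβ) (λ w cw → Rhs-Z x α w cα cw) ⟩
    ev x (Q′ β) (Z (1ℤ + - x) α)
      ≡⟨ Q′-Z x β α cβ ⟩
    ⟦ β == α ⟧
      ≡⟨ eval-δ x β α ⟨
    eval x (δ β α) ∎)) ,
  (λ β → eval-injective (coeffOf (spec (+ 1) (Rhs α)) β) (δ β α) (λ x → begin
    eval x (coeffOf (spec (+ 1) (Rhs α)) β)
      ≡⟨ eval-spec x (+ 1) (Rhs α) β ⟩
    eval 1ℤ (coeffOf (Rhs α) β)
      ≡⟨ Rhs-at-1 α β cα ⟩
    ⟦ β == α ⟧
      ≡⟨ eval-δ x β α ⟨
    eval x (δ β α) ∎)) ,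
  (λ β cβ → eval-injective (pair (S β) (spec (+ 0) (Rhs α))) (δ β α) (λ x → begin
    eval x (pair (S β) (spec (+ 0) (Rhs α)))
      ≡⟨ eval-pair x (S β) (spec (+ 0) (Rhs α)) ⟩
    ev x (S β) (λ w → eval x (coeffOf (spec (+ 0) (Rhs α)) w))
      -- `spec` makes every coefficient constant, so evaluation at any `x` yields the value at q =
      -- 0, and `1ℤ + - 0ℤ` computes to `1ℤ`.
      ≡⟨ ev-cong x (S-composed β cβ) (λ w cw →
           trans (eval-spec x (+ 0) (Rhs α) w) (Rhs-Z 0ℤ α w cα cw)) ⟩
    ev x (S β) (Z 1ℤ α)
      ≡⟨ S-Z x β α cβ ⟩
    ⟦ β == α ⟧
      ≡⟨ eval-δ x β α ⟨
    eval x (δ β α) ∎))
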